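{- Let $A\in\mathbb{Z}^{m\times n}$ and let $A_B$ be its bouquet matrix. Then the Markov complexity of $A$ is greater than or equal to the Markov complexity of $A_B$: $m(A)\ge m(A_B)$.
   Context: For $A\in\mathbb{Z}^{m\times n}$ and $r\ge2$, the $r$-th Lawrence lifting $A^{(r)}$ is the $(rm+n)\times rn$ matrix with $r$ copies of $A$ on the block diagonal (zeros elsewhere in these block rows) and final block row $(I_n\ I_n\ \cdots\ I_n)$. Elements of $\operatorname{Ker}_{\mathbb{Z}}(A^{(r)})$ are identified with $r\times n$ integer matrices whose rows lie in $\operatorname{Ker}_{\mathbb{Z}}(A)$ and sum to zero; the type of such an element is its number of nonzero rows. For an integer matrix $M$ with $N$ columns, a Markov basis is a finite set $\mathcal{M}\subseteq\operatorname{Ker}_{\mathbb{Z}}(M)$ such that whenever $\mathbf{w},\mathbf{u}\in\mathbb{N}^N$ with $\mathbf{w}-\mathbf{u}\in\operatorname{Ker}_{\mathbb{Z}}(M)$ there exist $\mathbf{v}_1,\ldots,\mathbf{v}_p\in\mathcal{M}\cup(-\mathcal{M})$ with $\mathbf{w}-\sum_{i\le l}\mathbf{v}_i\in\mathbb{N}^N$ for all $l$ and $\mathbf{w}-\mathbf{u}=\sum_{i=1}^p\mathbf{v}_i$; it is minimal if no proper subset is a Markov basis. The universal Markov basis of $M$ is the union of all minimal Markov bases (vectors differing by sign identified). The Markov complexity $m(A)$ is the largest type of any element of the universal Markov basis of $A^{(r)}$, as $r\ge2$ varies. Bouquets. Let $A=[\mathbf{a}_1,\ldots,\mathbf{a}_n]$.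 Fix a matrix whose columns form a $\mathbb{Z}$-basis of $\operatorname{Ker}_{\mathbb{Z}}(A)$ and let the Gale transform $G(\mathbf{a}_i)$ be its $i$-th row. Call $i\neq j$ adjacent if some $\mathbf{v}\in\mathbb{Z}^m$ makes $\mathbf{v}\cdot A$ nonzero exactly in positions $i,j$; the bouquets are the classes of the equivalence relation on columns generated by adjacency. A bouquet is free if $G(\mathbf{a}_i)=\mathbf{0}$ for its columns, non-free otherwise (then its Gale transforms are nonzero and pairwise linearly dependent). For a bouquet $B$ define $\mathbf{c}_B\in\mathbb{Z}^n$: if $B$ is free, any nonzero vector with support $\{i:\mathbf{a}_i\in B\}$ and positive first nonzero coordinate; if non-free, pick $j$ with $G(\mathbf{a}_i)_j\neq0$ for all $\mathbf{a}_i\in B$, let $g=\gcd(G(\mathbf{a}_i)_j:\mathbf{a}_i\in B)$, $i_0$ the smallest index in $B$, $\varepsilon$ the sign of $G(\mathbf{a}_{i_0})_j$, and $(\mathbf{c}_B)_i=\varepsilon G(\mathbf{a}_i)_j/g$ for $\mathbf{a}_i\in B$, $0$ otherwise. Set $\mathbf{a}_B=\sum_i(\mathbf{c}_B)_i\mathbf{a}_i$. With bouquets $B_1,\ldots,B_q$, the bouquet matrix is $A_B=[\mathbf{a}_{B_1},\ldots,\mathbf{a}_{B_q}]\in\mathbb{Z}^{m\times q}$. -}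

module Defs where

open import Data.Bool using (Bool; true; false; if_then_else_)
open import Data.Nat as ℕ using (ℕ; zero; suc)
open import Data.Nat.GCD using (gcd)
open import Data.Integer as ℤ using (ℤ; +_; -_; ∣_∣; sign; _◃_)
open import Data.Fin as Fin using (Fin; _≟_)
open import Data.Fin.Subset using (Subset; _∈_; _∉_)
open import Data.Vec as Vec using (Vec; []; _∷_; lookup; replicate; tabulate; zipWith; map; foldr; concat; transpose; splitAt; count; _++_)
open import Data.Vec.Properties using (≡-dec)
open import Data.List as List using (List)
open import Data.List.Membership.Propositional as LM using ()
open import Data.List.Relation.Unary.All as All using (All)
open import Data.Product using (Σ; Σ-syntax; ∃; ∃-syntax; _×_; _,_; proj₁; proj₂)
open import Data.Sum using (_⊎_)
open import Relation.Nullary using (¬_; ¬?; does)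
open import Relation.Binary.PropositionalEquality using (_≡_; _≢_)
open import Relation.Binary.Construct.Closure.Equivalence using (EqClosure)

Mat : ℕ → ℕ → Set
Mat m n = Vec (Vec ℤ n) m

zeroV : ∀ {n} → Vec ℤ n
zeroV = replicate _ (+ 0)

_⊕_ : ∀ {n} → Vec ℤ n → Vec ℤ n → Vec ℤ n
_⊕_ = zipWith ℤ._+_

_⊖_ : ∀ {n} → Vec ℤ n → Vec ℤ n → Vec ℤ n
_⊖_ = zipWith ℤ._-_

negV : ∀ {n} → Vec ℤ n → Vec ℤ n
negV = map -_

dot : ∀ {n} → Vec ℤ n → Vec ℤ n → ℤ
dot u v = foldr _ ℤ._+_ (+ 0) (zipWith ℤ._*_ u v)

_·ᵥ_ : ∀ {m n} → Mat m n → Vec ℤ n → Vec ℤ m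
M ·ᵥ u = map (λ row → dot row u) M

_ᵥ·_ : ∀ {m n} → Vec ℤ m → Mat m n → Vec ℤ n
v ᵥ· M = map (dot v) (transpose M)

column : ∀ {m n} → Fin n → Mat m n → Vec ℤ m
column l M = map (λ row → lookup row l) M

toℤV : ∀ {n} → Vec ℕ n → Vec ℤ n
toℤV = map (λ x → + x)

NonNegV : ∀ {n} → Vec ℤ n → Set
NonNegV u = ∀ i → + 0 ℤ.≤ lookup u i

InKer : ∀ {m n} → Mat m n → Vec ℤ n → Set
InKer M u = M ·ᵥ u ≡ zeroV

unitV : ∀ {n} → Fin n → Vec ℤ n
unitV j = tabulate (λ k → if does (j ≟ k) then + 1 else + 0)

-- r-th Lawrence lifting: (r*m + n) × (r*n); columns are grouped in
-- r consecutive blocks of n columns (block k = k-th copy of A).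
lawrence : ∀ {m n} (r : ℕ) → Mat m n → Mat (r ℕ.* m ℕ.+ n) (r ℕ.* n)
lawrence {m} {n} r A =
  concat (tabulate {n = r} λ k →
            map (λ a → concat (tabulate {n = r} λ k′ →
                   if does (k ≟ k′) then a else zeroV)) A)
  ++ tabulate (λ j → concat (replicate r (unitV j)))

blocks : ∀ {A : Set} {n} (r : ℕ) → Vec A (r ℕ.* n) → Vec (Vec A n) r
blocks zero _ = []
blocks {n = n} (suc r) xs with splitAt n xs
... | ys , zs , _ = ys ∷ blocks r zs

-- the type of an element of Ker(A^{(r)}), seen as an r×n matrix:
-- the number of nonzero rows (blocks)
typeOf : ∀ {n} (r : ℕ) → Vec ℤ (r ℕ.* n) → ℕ
typeOf r u = count (λ b → ¬? (≡-dec ℤ._≟_ b zeroV)) (blocks r u)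

_∈±_ : ∀ {N} → Vec ℤ N → List (Vec ℤ N) → Set
v ∈± L = (v LM.∈ L) ⊎ (negV v LM.∈ L)

-- Walk L w u : there are v₁,…,v_p ∈ L ∪ −L with every partial
-- difference w − Σ_{i≤l} vᵢ nonnegative and w − u = Σ vᵢ.
data Walk {N} (L : List (Vec ℤ N)) : Vec ℤ N → Vec ℤ N → Set where
  done : ∀ {w} → Walk L w w
  step : ∀ {w u} (v : Vec ℤ N) → v ∈± L → NonNegV (w ⊖ v) →
         Walk L (w ⊖ v) u → Walk L w u

IsMarkovBasis : ∀ {p N} → Mat p N → List (Vec ℤ N) → Set
IsMarkovBasis {N = N} M L =
  All (InKer M) L ×
  (∀ (w u : Vec ℕ N) → InKer M (toℤV w ⊖ toℤV u) → Walk L (toℤV w) (toℤV u))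

IsMinimalMarkovBasis : ∀ {p N} → Mat p N → List (Vec ℤ N) → Set
IsMinimalMarkovBasis M L =
  IsMarkovBasis M L ×
  (∀ (S : List (Vec ℤ _)) → All (LM._∈ L) S →
     (∃[ x ] (x LM.∈ L × ¬ (x LM.∈ S))) → ¬ IsMarkovBasis M S)

-- membership in the universal Markov basis (union of all minimal
-- Markov bases, elements identified up to sign)
InUniversalMarkovBasis : ∀ {p N} → Mat p N → Vec ℤ N → Set
InUniversalMarkovBasis M v =
  ∃[ L ] (IsMinimalMarkovBasis M L × v ∈± L)

IsUMBType : ∀ {m n} → Mat m n → ℕ → Set
IsUMBType {n = n} A t =
  Σ[ r ∈ ℕ ] (2 ℕ.≤ r × Σ[ u ∈ Vec ℤ (r ℕ.* n) ]
     (InUniversalMarkovBasis (lawrence r A) u × typeOf r u ≡ t))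

-- m(A) ≥ m(A′), where m(·) is the supremum (in ℕ ∪ {∞}) of the above types
MarkovComplexity≥ : ∀ {m n m′ n′} → Mat m n → Mat m′ n′ → Set
MarkovComplexity≥ A A′ =
  ∀ t → IsUMBType A′ t → ∃[ t′ ] (IsUMBType A t′ × t ℕ.≤ t′)

-- G : n × d, whose columns form a ℤ-basis of Ker_ℤ(A);
-- row i of G is the Gale transform G(aᵢ).
IsGaleMatrix : ∀ {m n d} → Mat m n → Mat n d → Set
IsGaleMatrix A G =
  (∀ t → InKer A (column t G)) ×
  (∀ u → InKer A u → ∃[ λ′ ] (G ·ᵥ λ′ ≡ u)) ×
  (∀ λ′ → G ·ᵥ λ′ ≡ zeroV → λ′ ≡ zeroV)

Adjacent : ∀ {m n} → Mat m n → Fin n → Fin n → Set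
Adjacent {m} A i j =
  i ≢ j × ∃[ v ] (∀ k → (lookup (v ᵥ· A) k ≢ + 0 → (k ≡ i ⊎ k ≡ j)) ×
                        ((k ≡ i ⊎ k ≡ j) → lookup (v ᵥ· A) k ≢ + 0))

IsBouquet : ∀ {m n} → Mat m n → Subset n → Set
IsBouquet A B =
  ∃[ i ] (∀ k → (k ∈ B → EqClosure (Adjacent A) i k) ×
                (EqClosure (Adjacent A) i k → k ∈ B))

gcdOn : ∀ {n} → Subset n → (Fin n → ℤ) → ℕ
gcdOn [] f = 0
gcdOn (true ∷ B) f = gcd ∣ f Fin.zero ∣ (gcdOn B (λ i → f (Fin.suc i)))
gcdOn (false ∷ B) f = gcdOn B (λ i → f (Fin.suc i))

IsBouquetVector : ∀ {n d} → Mat n d → Subset n → Vec ℤ n → Set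
IsBouquetVector G B c =
  ( (∀ i → i ∈ B → lookup G i ≡ zeroV) ×
    c ≢ zeroV ×
    (∀ i → (lookup c i ≢ + 0 → i ∈ B) × (i ∈ B → lookup c i ≢ + 0)) ×
    (∃[ i ] (+ 0 ℤ.< lookup c i × (∀ k → k Fin.< i → lookup c k ≡ + 0))) )
  ⊎
  ( (∃[ i ] (i ∈ B × lookup G i ≢ zeroV)) ×
    ∃[ j ] ( (∀ i → i ∈ B → lookup (lookup G i) j ≢ + 0) ×
      ∃[ i₀ ] ( i₀ ∈ B × (∀ k → k Fin.< i₀ → k ∉ B) ×
        let g = gcdOn B (λ i → lookup (lookup G i) j)
            ε = sign (lookup (lookup G i₀) j) ◃ 1
        in ∀ i → (i ∈ B → (+ g) ℤ.* lookup c i ≡ ε ℤ.* lookup (lookup G i) j) ×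
                 (i ∉ B → lookup c i ≡ + 0) ) ) )

IsBouquetMatrix : ∀ {m n q} → Mat m n → Mat m q → Set
IsBouquetMatrix {m} {n} {q} A AB =
  Σ[ d ∈ ℕ ] Σ[ G ∈ Mat n d ] (IsGaleMatrix A G ×
  Σ[ Bs ∈ Vec (Subset n) q ]
    ( (∀ l → IsBouquet A (lookup Bs l)) ×
      (∀ B → IsBouquet A B → ∃[ l ] (lookup Bs l ≡ B)) ×
      (∀ l l′ → lookup Bs l ≡ lookup Bs l′ → l ≡ l′) ×
      Σ[ cs ∈ Vec (Vec ℤ n) q ]
        (∀ l → IsBouquetVector G (lookup Bs l) (lookup cs l) ×
               column l AB ≡ A ·ᵥ lookup cs l)))

module Submission where

-- A vector u of Ker M lies in the universal Markov basis of a homogeneous M exactly when u⁺ and u⁻ are not linked,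
-- i.e. not joined by a chain of points of their fibre in which consecutive points share a positive coordinate.
-- One direction: after subtracting a shared coordinate, moves of smaller degree do the step, so u is redundant in every
-- Markov basis.  The other: build a Markov basis by degree as in Kruskal's algorithm, offering u first in its degree.
-- Finite Markov bases exist because the pairs (w , u) with M w = M u form a finitely generated monoid.
--
-- The bouquet vectors give an isomorphism D : Ker A_B → Ker A, applied row by row to the Lawrence liftings.
-- The fibre of (D u)⁺ embeds into that of u⁺, but at a negative coefficient it sees the complement of a point z in |u|.
-- If two consecutive points z, z′ have room left at such a place, then both are bounded by |u| in that column,
-- and both column sums equal half that of |u|; disjoint supports would leave no room, so z and z′ share a coordinate too.
-- Hence D u is again in the universal Markov basis, and it has as many nonzero rows as u.

open import Defs
open import Data.Nat as ℕ using (ℕ; zero; suc)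
import Data.Nat.Properties as ℕP
open import Data.Nat.GCD using (gcd; gcd-GCD; module Bézout)
open import Data.Integer as ℤ using (ℤ; +_; -_; -[1+_]; ∣_∣; _+_; _*_; _-_; _≤_; _<_; 0ℤ; 1ℤ; +≤+; -≤+; +<+)
import Data.Integer.Properties as ℤP
open import Data.Integer.Tactic.RingSolver using (solve-∀)
open import Algebra.Properties.Semiring.Sum ℤP.+-*-semiring
  using (sum; sum-cong-≗; ∑-distrib-+; ∑-comm; *-distribˡ-sum; *-distribʳ-sum; sum-replicate-zero)
import Data.Sign as Sign
open import Data.Bool using (true; false; if_then_else_)
open import Data.Fin as Fin using (Fin)
import Data.Fin.Properties as FinP
open import Data.Fin.Properties using (any?; all?; combine-surjective)
open import Data.Fin.Subset using (Subset; _∈_; _∉_)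
open import Data.Fin.Subset.Properties using (_∈?_; ⊆-antisym)
open import Data.Vec as Vec using (Vec; []; _∷_; lookup; tabulate; map; here; there)
open import Data.Vec.Properties
  using (lookup-zipWith; lookup-map; lookup-replicate; tabulate-cong; tabulate∘lookup; lookup∘tabulate; ≡-dec;
         lookup-++ˡ; lookup-++ʳ; map-++; lookup-concat; lookup-⊛; []=⇒lookup; lookup⇒[]=; ∷-injectiveˡ; ∷-injectiveʳ)
import Data.Vec.Relation.Unary.All.Properties as VAllP
open import Data.List as List using (List; []; _∷_; filter; upTo; cartesianProductWith)
import Data.List.Membership.Propositional as LM
open import Data.List.Membership.Propositional.Properties
  using (∈-filter⁺; ∈-filter⁻; ∈-cartesianProductWith⁺; ∈-cartesianProductWith⁻; ∈-upTo⁺; ∈-map⁺; ∈-map⁻)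
open import Data.List.Relation.Unary.All as All using (All; []; _∷_)
open import Data.List.Relation.Unary.Any using (here; there)
open import Data.Product using (∃; ∃-syntax; Σ-syntax; _×_; _,_; proj₁; proj₂)
open import Data.Sum using (_⊎_; inj₁; inj₂)
open import Data.Empty using (⊥; ⊥-elim)
open import Function using (_∘_; id)
open import Relation.Nullary
open import Relation.Nullary.Decidable using (_×-dec_; _⊎-dec_; map′; dec-true)
open import Relation.Binary using (tri<; tri≈; tri>)
open import Relation.Binary.PropositionalEquality
open import Relation.Binary.Construct.Closure.Equivalence using (EqClosure; transitive; symmetric)
open import Relation.Binary.Construct.Closure.ReflexiveTransitive using (ε; _◅_)
open import Relation.Binary.Construct.Closure.Symmetric using (fwd; bwd)

-- The obstacle is that the coefficients inside one bouquet may have both signs, so `D` does not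
-- carry positive parts to positive parts. A point over the fibre of u⁺ must be nonnegative at a
-- positive coefficient and stay below |u| at a negative one. The fibre for `A` is therefore the
-- smaller one, which helps, but its points have more places where two of them can meet, which could
-- create links that `AB` does not have; ruling these out is the heart of the matter. Each bouquet
-- vector is normalised to be positive somewhere, and there z is visible up to a positive factor.
-- The identity blocks of a Lawrence lifting serve twice: zero column sums supply the grading by
-- degree, and equal column sums within a fibre allow the comparison with |u|. Membership in the
-- universal Markov basis asks for an actual minimal basis, and the argument is constructive. Hence
-- a finite Markov basis must be produced as a supply of candidates, and it must be decided whether
-- a candidate's two parts are already joined; homogeneity makes this possible by keeping walks
-- inside a finite box.

private variable
  m n k q d : ℕ
  L S : List (Vec ℤ n)
  a b c v w : Vec ℤ n

-- Integer vectors and sums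

infixl 6 _⟨+⟩_
_⟨+⟩_ : ∀ {a b} → 0ℤ ≤ a → 0ℤ ≤ b → 0ℤ ≤ a + b
_⟨+⟩_ = ℤP.+-mono-≤

0≤* : ∀ {a b} → 0ℤ ≤ a → 0ℤ ≤ b → 0ℤ ≤ a * b
0≤* {+ m} {+ n} _ _ = subst (0ℤ ≤_) (ℤP.pos-* m n) (+≤+ ℕ.z≤n)

≤-from-gap : ∀ {a b c} → 0ℤ ≤ c → b ≡ a + c → a ≤ b
≤-from-gap {a} {b} {c} 0≤c eq = subst₂ _≤_ (ℤP.+-identityʳ a) (sym eq) (ℤP.+-monoʳ-≤ a 0≤c)

gap : ∀ {a b} → a ≤ b → 0ℤ ≤ b - a
gap = ℤP.i≤j⇒0≤j-i

pos : ℤ → ℤ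
pos (+ n)    = + n
pos -[1+ _ ] = 0ℤ

0≤pos : ∀ x → 0ℤ ≤ pos x
0≤pos (+ n)    = +≤+ ℕ.z≤n
0≤pos -[1+ n ] = ℤP.≤-refl

pos-split : ∀ x → x ≡ pos x - pos (- x)
pos-split (+ zero)     = refl
pos-split (+ (suc n))  = sym (ℤP.+-identityʳ _)
pos-split -[1+ n ]     = refl

pos-least : ∀ {x a} → 0ℤ ≤ a → 0ℤ ≤ a - x → pos x ≤ a
pos-least {+ n}      0≤a h = ℤP.0≤i-j⇒j≤i h
pos-least { -[1+ n ]} 0≤a h = 0≤a

pos-of-nonneg : ∀ {x} → 0ℤ ≤ x → pos x ≡ x
pos-of-nonneg {+ n} _ = refl

pos-of-nonpos : ∀ {x} → x ≤ 0ℤ → pos x ≡ 0ℤ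
pos-of-nonpos {+ zero}   _ = refl
pos-of-nonpos {+ suc n}  (+≤+ ())
pos-of-nonpos { -[1+ n ]} _ = refl

vec-ext : ∀ {A : Set} {u v : Vec A n} → (∀ i → lookup u i ≡ lookup v i) → u ≡ v
vec-ext {u = u} {v} h =
  trans (sym (tabulate∘lookup u)) (trans (tabulate-cong h) (tabulate∘lookup v))

lookup-⊕ : ∀ (u v : Vec ℤ n) i → lookup (u ⊕ v) i ≡ lookup u i + lookup v i
lookup-⊕ u v i = lookup-zipWith _+_ i u v

lookup-⊖ : ∀ (u v : Vec ℤ n) i → lookup (u ⊖ v) i ≡ lookup u i - lookup v i
lookup-⊖ u v i = lookup-zipWith _-_ i u v

lookup-negV : ∀ (u : Vec ℤ n) i → lookup (negV u) i ≡ - lookup u i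
lookup-negV u i = lookup-map i -_ u

lookup-zeroV : ∀ (i : Fin n) → lookup zeroV i ≡ 0ℤ
lookup-zeroV i = lookup-replicate i 0ℤ

posV : Vec ℤ n → Vec ℤ n
posV = map pos

lookup-posV : ∀ (u : Vec ℤ n) i → lookup (posV u) i ≡ pos (lookup u i)
lookup-posV u i = lookup-map i pos u

lookup-posV-negV : ∀ (u : Vec ℤ n) i → lookup (posV (negV u)) i ≡ pos (- lookup u i)
lookup-posV-negV u i = trans (lookup-posV (negV u) i) (cong pos (lookup-negV u i))

posV-nonneg : ∀ (u : Vec ℤ n) → NonNegV (posV u)
posV-nonneg u i = subst (0ℤ ≤_) (sym (lookup-posV u i)) (0≤pos _)

negV-involutive : ∀ (u : Vec ℤ n) → negV (negV u) ≡ u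
negV-involutive u = vec-ext λ i →
  trans (lookup-negV (negV u) i) (trans (cong (-_) (lookup-negV u i)) (ℤP.neg-involutive _))

posV-split : ∀ (u : Vec ℤ n) → posV u ⊖ posV (negV u) ≡ u
posV-split u = vec-ext λ i →
  trans (lookup-⊖ (posV u) _ i)
    (trans (cong₂ _-_ (lookup-posV u i) (lookup-posV-negV u i)) (sym (pos-split (lookup u i))))

⊖-⊖ : ∀ (a v : Vec ℤ n) → a ⊖ (a ⊖ v) ≡ v
⊖-⊖ a v = vec-ext λ i →
  trans (lookup-⊖ a _ i) (trans (cong (λ z → lookup a i - z) (lookup-⊖ a v i)) (cancel (lookup a i) (lookup v i)))
  where
  cancel : ∀ x y → x - (x - y) ≡ y
  cancel = solve-∀

⊖-negV : ∀ (a b : Vec ℤ n) → negV (a ⊖ b) ≡ b ⊖ a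
⊖-negV a b = vec-ext λ i →
  trans (lookup-negV (a ⊖ b) i) (trans (cong (-_) (lookup-⊖ a b i)) (trans (flip (lookup a i) (lookup b i)) (sym (lookup-⊖ b a i))))
  where
  flip : ∀ x y → - (x - y) ≡ y - x
  flip = solve-∀

⊕-⊖-cancel : ∀ (a b : Vec ℤ n) → a ⊕ (b ⊖ a) ≡ b
⊕-⊖-cancel a b = vec-ext λ i →
  trans (lookup-⊕ a _ i) (trans (cong (_+_ (lookup a i)) (lookup-⊖ b a i)) (cancel (lookup a i) (lookup b i)))
  where
  cancel : ∀ x y → x + (y - x) ≡ y
  cancel = solve-∀

⊖-⊕-cancel : ∀ (a b : Vec ℤ n) → (a ⊖ b) ⊕ b ≡ a
⊖-⊕-cancel a b = vec-ext λ i →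
  trans (lookup-⊕ (a ⊖ b) b i) (trans (cong (_+ lookup b i) (lookup-⊖ a b i)) (cancel (lookup a i) (lookup b i)))
  where
  cancel : ∀ x y → x - y + y ≡ x
  cancel = solve-∀

abs-toℤV : ∀ (x : Vec ℤ n) → NonNegV x → toℤV (map ∣_∣ x) ≡ x
abs-toℤV x hx = vec-ext λ i → trans (lookup-map i _ (map ∣_∣ x))
  (trans (cong +_ (lookup-map i _ x)) (ℤP.0≤i⇒+∣i∣≡i (hx i)))

toℤV-nonneg : ∀ (x : Vec ℕ n) → NonNegV (toℤV x)
toℤV-nonneg x i = subst (0ℤ ≤_) (sym (lookup-map i _ x)) (+≤+ ℕ.z≤n)

⊖-translate : ∀ (a b c : Vec ℤ n) → (a ⊕ c) ⊖ (b ⊕ c) ≡ a ⊖ b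
⊖-translate a b c = vec-ext λ i →
  trans (lookup-⊖ (a ⊕ c) _ i)
    (trans (cong₂ _-_ (lookup-⊕ a c i) (lookup-⊕ b c i)) (trans (cancel (lookup a i) (lookup b i) (lookup c i)) (sym (lookup-⊖ a b i))))
  where
  cancel : ∀ x y z → (x + z) - (y + z) ≡ x - y
  cancel = solve-∀

⊕-nonneg : ∀ {a b : Vec ℤ n} → NonNegV a → NonNegV b → NonNegV (a ⊕ b)
⊕-nonneg {a = a} {b} ha hb i = subst (0ℤ ≤_) (sym (lookup-⊕ a b i)) (ha i ⟨+⟩ hb i)

⊖-nonneg : ∀ {a b : Vec ℤ n} → (∀ i → lookup b i ≤ lookup a i) → NonNegV (a ⊖ b)
⊖-nonneg {a = a} {b} h i = subst (0ℤ ≤_) (sym (lookup-⊖ a b i)) (gap (h i))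

posV-least : ∀ {a v : Vec ℤ n} → NonNegV a → NonNegV (a ⊖ v) → ∀ i → lookup (posV v) i ≤ lookup a i
posV-least {a = a} {v} ha hv i =
  subst (_≤ lookup a i) (sym (lookup-posV v i))
    (pos-least (ha i) (subst (0ℤ ≤_) (lookup-⊖ a v i) (hv i)))

sum-nonneg : ∀ {f : Fin n → ℤ} → (∀ i → 0ℤ ≤ f i) → 0ℤ ≤ sum f
sum-nonneg {zero}  h = ℤP.≤-refl
sum-nonneg {suc n} h = h Fin.zero ⟨+⟩ sum-nonneg (h ∘ Fin.suc)

sum-neg : ∀ (f : Fin n → ℤ) → sum (λ i → - f i) ≡ - sum f
sum-neg {zero}  f = refl
sum-neg {suc n} f = trans (cong (_+_ (- f Fin.zero)) (sum-neg (f ∘ Fin.suc))) (sym (ℤP.neg-distrib-+ (f Fin.zero) _))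

sum-sub : ∀ (f g : Fin n → ℤ) → sum (λ i → f i - g i) ≡ sum f - sum g
sum-sub f g = trans (∑-distrib-+ f (λ i → - g i)) (cong (_+_ (sum f)) (sum-neg g))

sum-zero : ∀ {f : Fin n → ℤ} → (∀ i → f i ≡ 0ℤ) → sum f ≡ 0ℤ
sum-zero {n} h = trans (sum-cong-≗ h) (sum-replicate-zero n)

term≤sum : ∀ {f : Fin n → ℤ} → (∀ i → 0ℤ ≤ f i) → ∀ i → f i ≤ sum f
term≤sum {suc n} h Fin.zero    = ≤-from-gap (sum-nonneg (h ∘ Fin.suc)) refl
term≤sum {suc n} {f} h (Fin.suc i) =
  ℤP.≤-trans (term≤sum (h ∘ Fin.suc) i) (≤-from-gap (h Fin.zero) (ℤP.+-comm (f Fin.zero) _))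

sum-zero⇒zero : ∀ {f : Fin n → ℤ} → (∀ i → 0ℤ ≤ f i) → sum f ≡ 0ℤ → ∀ i → f i ≡ 0ℤ
sum-zero⇒zero h eq i = ℤP.≤-antisym (subst (_ ≤_) eq (term≤sum h i)) (h i)

sum-mono-≤ : ∀ {f g : Fin n → ℤ} → (∀ i → f i ≤ g i) → sum f ≤ sum g
sum-mono-≤ {zero}  h = ℤP.≤-refl
sum-mono-≤ {suc n} h = ℤP.+-mono-≤ (h Fin.zero) (sum-mono-≤ (h ∘ Fin.suc))

dot-sum : ∀ (u v : Vec ℤ n) → dot u v ≡ sum (λ i → lookup u i * lookup v i)
dot-sum []      []      = refl
dot-sum (x ∷ u) (y ∷ v) = cong (_+_ (x * y)) (dot-sum u v)

dot-⊖ : ∀ (r a b : Vec ℤ n) → dot r (a ⊖ b) ≡ dot r a - dot r b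
dot-⊖ []      []      []      = refl
dot-⊖ (x ∷ r) (y ∷ a) (z ∷ b) = trans (cong (_+_ (x * (y - z))) (dot-⊖ r a b)) (expand x y z _ _)
  where
  expand : ∀ x y z s t → x * (y - z) + (s - t) ≡ (x * y + s) - (x * z + t)
  expand = solve-∀

inKer⁺ : ∀ {M : Mat m n} {u} → (∀ i → dot (lookup M i) u ≡ 0ℤ) → InKer M u
inKer⁺ {M = M} {u} h = vec-ext λ i → trans (lookup-map i _ M) (trans (h i) (sym (lookup-zeroV i)))

inKer⁻ : ∀ {M : Mat m n} {u} → InKer M u → ∀ i → dot (lookup M i) u ≡ 0ℤ
inKer⁻ {M = M} eq i =
  trans (sym (lookup-map i _ M)) (trans (cong (λ w → lookup w i) eq) (lookup-zeroV i))

ker-⊖ : ∀ (M : Mat m n) {u v} → InKer M u → InKer M v → InKer M (u ⊖ v)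
ker-⊖ M {u} {v} hu hv = inKer⁺ λ i →
  trans (dot-⊖ (lookup M i) u v) (cong₂ _-_ (inKer⁻ hu i) (inKer⁻ hv i))

ker-zero : ∀ (M : Mat m n) → InKer M zeroV
ker-zero M = inKer⁺ λ i → trans (dot-sum (lookup M i) zeroV)
  (sum-zero λ j → trans (cong (lookup (lookup M i) j *_) (lookup-zeroV j)) (ℤP.*-zeroʳ (lookup (lookup M i) j)))

negV-as-⊖ : ∀ (u : Vec ℤ n) → negV u ≡ zeroV ⊖ u
negV-as-⊖ u = vec-ext λ i → trans (lookup-negV u i)
  (sym (trans (lookup-⊖ zeroV u i) (trans (cong (_- lookup u i) (lookup-zeroV i)) (ℤP.+-identityˡ _))))

ker-negV : ∀ (M : Mat m n) {u} → InKer M u → InKer M (negV u)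
ker-negV M {u} hu = subst (InKer M) (sym (negV-as-⊖ u)) (ker-⊖ M (ker-zero M) hu)

total : Vec ℤ n → ℤ
total v = sum (lookup v)

total-⊖ : ∀ (a b : Vec ℤ n) → total (a ⊖ b) ≡ total a - total b
total-⊖ a b = trans (sum-cong-≗ (lookup-⊖ a b)) (sum-sub (lookup a) (lookup b))

tight : ∀ {a b : Vec ℤ n} → (∀ i → lookup b i ≤ lookup a i) → total a ≤ total b → a ≡ b
tight {a = a} {b} h le = vec-ext λ i →
  ℤP.i-j≡0⇒i≡j _ _ (sum-zero⇒zero (gap ∘ h) zero-sum i)
  where
  zero-sum : sum (λ i → lookup a i - lookup b i) ≡ 0ℤ
  zero-sum = ℤP.≤-antisym
    (subst (_≤ 0ℤ) (sym (sum-sub (lookup a) (lookup b))) (ℤP.i≤j⇒i-j≤0 le))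
    (sum-nonneg (gap ∘ h))

dot-⊕ : ∀ (r a b : Vec ℤ n) → dot r (a ⊕ b) ≡ dot r a + dot r b
dot-⊕ []      []      []      = refl
dot-⊕ (x ∷ r) (y ∷ a) (z ∷ b) = trans (cong (_+_ (x * (y + z))) (dot-⊕ r a b)) (expand x y z (dot r a) (dot r b))
  where
  expand : ∀ x y z s t → x * (y + z) + (s + t) ≡ (x * y + s) + (x * z + t)
  expand = solve-∀

sum-single : ∀ (f : Fin n → ℤ) i → (∀ k → i ≢ k → f k ≡ 0ℤ) → sum f ≡ f i
sum-single f Fin.zero    h = trans (cong (_+_ (f Fin.zero)) (sum-zero λ k → h (Fin.suc k) λ ())) (ℤP.+-identityʳ _)
sum-single f (Fin.suc i) h = trans
  (cong₂ _+_ (h Fin.zero λ ()) (sum-single (f ∘ Fin.suc) i λ k i≢k → h (Fin.suc k) (i≢k ∘ FinP.suc-injective)))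
  (ℤP.+-identityˡ _)

unitV-self : ∀ (i : Fin n) → lookup (unitV i) i ≡ 1ℤ
unitV-self i rewrite lookup∘tabulate (λ k → if does (i Fin.≟ k) then 1ℤ else 0ℤ) i with i Fin.≟ i
... | yes _  = refl
... | no i≢i = ⊥-elim (i≢i refl)

unitV-other : ∀ {i k : Fin n} → i ≢ k → lookup (unitV i) k ≡ 0ℤ
unitV-other {i = i} {k} i≢k rewrite lookup∘tabulate (λ k → if does (i Fin.≟ k) then 1ℤ else 0ℤ) k with i Fin.≟ k
... | yes i≡k = ⊥-elim (i≢k i≡k)
... | no _    = refl

unitV-≤ : ∀ {i : Fin n} {X : Fin n → ℤ} → (∀ k → 0ℤ ≤ X k) → 1ℤ ≤ X i → ∀ k → lookup (unitV i) k ≤ X k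
unitV-≤ {i = i} h 1≤ k with i Fin.≟ k
... | yes refl = subst (_≤ _) (sym (unitV-self i)) 1≤
... | no i≢k   = subst (_≤ _) (sym (unitV-other i≢k)) (h k)

unitV-nonneg : ∀ (i : Fin n) → NonNegV (unitV i)
unitV-nonneg i k with i Fin.≟ k
... | yes refl = subst (0ℤ ≤_) (sym (unitV-self i)) (+≤+ ℕ.z≤n)
... | no i≢k   = subst (0ℤ ≤_) (sym (unitV-other i≢k)) ℤP.≤-refl

unitV-total : ∀ (i : Fin n) → total (unitV i) ≡ 1ℤ
unitV-total i = trans (sum-single (lookup (unitV i)) i λ k → unitV-other) (unitV-self i)

dot-unitV : ∀ (b : Vec ℤ n) i → dot b (unitV i) ≡ lookup b i
dot-unitV b i = trans (dot-sum b (unitV i))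
  (trans (sum-single _ i λ k i≢k → trans (cong (lookup b k *_) (unitV-other i≢k)) (ℤP.*-zeroʳ (lookup b k)))
         (trans (cong (lookup b i *_) (unitV-self i)) (ℤP.*-identityʳ (lookup b i))))

sum-++ : ∀ m (f : Fin (m ℕ.+ n) → ℤ) → sum f ≡ sum (λ i → f (i Fin.↑ˡ n)) + sum (λ j → f (m Fin.↑ʳ j))
sum-++ zero    f = sym (ℤP.+-identityˡ _)
sum-++ (suc m) f = trans (cong (_+_ (f Fin.zero)) (sum-++ m (f ∘ Fin.suc))) (sym (ℤP.+-assoc (f Fin.zero) _ _))

-- Walks

_≟V_ : (u v : Vec ℤ n) → Dec (u ≡ v)
_≟V_ = ≡-dec ℤ._≟_

∈±-negV : v ∈± L → negV v ∈± L
∈±-negV {v = v} (inj₁ v∈L) = inj₂ (subst (LM._∈ _) (sym (negV-involutive v)) v∈L)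
∈±-negV         (inj₂ n∈L) = inj₁ n∈L

-- `step` fixes the next point as `a ⊖ v` on the nose; here the next point is given and the move is
-- recovered as a difference.
move : a ⊖ b ≡ v → v ∈± L → NonNegV b → Walk L b w → Walk L a w
move {a = a} {b} refl v∈L hb rest =
  step (a ⊖ b) v∈L (subst NonNegV (sym (⊖-⊖ a b)) hb) (subst (λ x → Walk _ x _) (sym (⊖-⊖ a b)) rest)

walk-trans : Walk L a b → Walk L b c → Walk L a c
walk-trans done            q = q
walk-trans (step v m nn p) q = step v m nn (walk-trans p q)

walk-sym : NonNegV a → Walk L a b → Walk L b a
walk-sym ha done = done
walk-sym {a = a} ha (step v v∈L nn p) =
  walk-trans (walk-sym nn p) (move back (∈±-negV v∈L) ha done)
  where
  back : (a ⊖ v) ⊖ a ≡ negV v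
  back = trans (sym (⊖-negV a (a ⊖ v))) (cong negV (⊖-⊖ a v))

walk-translate : NonNegV c → Walk L a b → Walk L (a ⊕ c) (b ⊕ c)
walk-translate hc done = done
walk-translate {c = c} {a = a} hc (step v v∈L nn p) =
  move (trans (⊖-translate a (a ⊖ v) c) (⊖-⊖ a v)) v∈L (⊕-nonneg {a = a ⊖ v} {c} nn hc) (walk-translate hc p)

walk-mono : (∀ {v} → v LM.∈ L → v LM.∈ S) → Walk L a b → Walk S a b
walk-mono f done                     = done
walk-mono f (step v (inj₁ i) nn p) = step v (inj₁ (f i)) nn (walk-mono f p)
walk-mono f (step v (inj₂ i) nn p) = step v (inj₂ (f i)) nn (walk-mono f p)

-- The least instance of the move `v`. By `cross` every other application is a translate of it, so a
-- crossable `v` can be replaced wherever it occurs.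
Crossable : List (Vec ℤ n) → Vec ℤ n → Set
Crossable S v = Walk S (posV v) (posV (negV v))

crossable-negV : Crossable S v → Crossable S (negV v)
crossable-negV {v = v} p =
  subst (λ x → Walk _ (posV (negV v)) (posV x)) (sym (negV-involutive v)) (walk-sym (posV-nonneg v) p)

crossable± : (∀ {v} → v LM.∈ L → Crossable S v) → v ∈± L → Crossable S v
crossable± f (inj₁ i) = f i
crossable± {v = v} f (inj₂ i) = subst (Crossable _) (negV-involutive v) (crossable-negV (f i))

-- Since `a` and `a ⊖ v` are both nonnegative, `posV v` lies below `a`; the walk is translated by
-- the nonnegative remainder `a ⊖ posV v`.
cross : NonNegV a → NonNegV (a ⊖ v) → Crossable S v → Walk S a (a ⊖ v)
cross {a = a} {v} ha hav p =
  subst₂ (Walk _) (⊕-⊖-cancel (posV v) a) end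
    (walk-translate (⊖-nonneg {a = a} {posV v} (posV-least {a = a} {v} ha hav)) p)
  where
  rearrange : ∀ x p q → (q + (x - p)) ≡ x - (p - q)
  rearrange = solve-∀
  end : posV (negV v) ⊕ (a ⊖ posV v) ≡ a ⊖ v
  end = vec-ext λ i → trans (lookup-⊕ (posV (negV v)) (a ⊖ posV v) i)
    (trans (cong (_+_ (lookup (posV (negV v)) i)) (lookup-⊖ a (posV v) i))
    (trans (rearrange (lookup a i) (lookup (posV v) i) (lookup (posV (negV v)) i))
    (trans (cong (λ z → lookup a i - z)
      (trans (sym (lookup-⊖ (posV v) (posV (negV v)) i)) (cong (λ z → lookup z i) (posV-split v))))
      (sym (lookup-⊖ a v i)))))

refine : (∀ {v} → v LM.∈ L → Crossable S v) → NonNegV a → Walk L a b → Walk S a b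
refine f ha done = done
refine f ha (step v v∈L nn p) = walk-trans (cross ha nn (crossable± f v∈L)) (refine f nn p)

self-crossable : v LM.∈ L → Crossable L v
self-crossable {v = v} v∈L = move (posV-split v) (inj₁ v∈L) (posV-nonneg (negV v)) done

markov-walk : ∀ {M : Mat m n} → IsMarkovBasis M L → NonNegV a → NonNegV b → InKer M (a ⊖ b) → Walk L a b
markov-walk {L = L} {a = a} {b} {M = M} (_ , W) ha hb k =
  subst₂ (Walk L) (abs-toℤV a ha) (abs-toℤV b hb)
    (W (map ∣_∣ a) (map ∣_∣ b) (subst (InKer M) (sym (cong₂ _⊖_ (abs-toℤV a ha) (abs-toℤV b hb))) k))

-- Every copy of `y` is deleted, because minimality compares lists by membership.
remove : Vec ℤ n → List (Vec ℤ n) → List (Vec ℤ n)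
remove y = filter (λ v → ¬? (v ≟V y))

∈-remove⁺ : ∀ {y} → v LM.∈ L → v ≢ y → v LM.∈ remove y L
∈-remove⁺ {y = y} = ∈-filter⁺ (λ v → ¬? (v ≟V y))

∈-remove⁻ : ∀ {y} → v LM.∈ remove y L → v LM.∈ L × v ≢ y
∈-remove⁻ {L = L} {y = y} = ∈-filter⁻ (λ v → ¬? (v ≟V y)) {xs = L}

-- Degrees and homogeneous kernels

weight : Vec ℤ n → ℤ
weight v = total (posV v)

0≤weight : ∀ (v : Vec ℤ n) → 0ℤ ≤ weight v
0≤weight v = sum-nonneg (posV-nonneg v)

Homogeneous : Mat m n → Set
Homogeneous M = ∀ v → InKer M v → total v ≡ 0ℤ

module Graded {m n : ℕ} (M : Mat m n) (homogeneous : Homogeneous M) where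

  total-invariant : InKer M (a ⊖ b) → total a ≡ total b
  total-invariant {a = a} {b = b} k = ℤP.i-j≡0⇒i≡j _ _ (trans (sym (total-⊖ a b)) (homogeneous _ k))

  weight-negV : InKer M v → weight (negV v) ≡ weight v
  weight-negV {v = v} k = sym (total-invariant {a = posV v} (subst (InKer M) (sym (posV-split v)) k))

  ker± : All (InKer M) L → v ∈± L → InKer M v
  ker± kL (inj₁ i) = All.lookup kL i
  ker± {v = v} kL (inj₂ i) = subst (InKer M) (negV-involutive v) (ker-negV M (All.lookup kL i))

  total-step : InKer M v → total (a ⊖ v) ≡ total a
  total-step {v = v} {a = a} k = sym (total-invariant {a = a} (subst (InKer M) (sym (⊖-⊖ a v)) k))

  weight-≤-total : NonNegV a → NonNegV (a ⊖ v) → weight v ≤ total a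
  weight-≤-total {a = a} {v = v} ha hav = sum-mono-≤ (posV-least {a = a} {v} ha hav)

  -- The fibre of weight v contains v only as the edge from its positive to its negative part.
  tight-source : NonNegV a → NonNegV (a ⊖ v) → total a ≤ weight v → a ≡ posV v
  tight-source {a = a} {v = v} ha hav le = tight (posV-least {a = a} {v} ha hav) le

  tight-target : NonNegV a → NonNegV (a ⊖ v) → total a ≤ weight v → a ⊖ v ≡ posV (negV v)
  tight-target {a = a} {v = v} ha hav le = trans (cong (_⊖ v) (tight-source ha hav le)) posV-⊖
    where
    flip : ∀ p q → p - (p - q) ≡ q
    flip = solve-∀
    posV-⊖ : posV v ⊖ v ≡ posV (negV v)
    posV-⊖ = trans (cong (posV v ⊖_) (sym (posV-split v))) (⊖-⊖ (posV v) (posV (negV v)))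

  -- Only the later points of a chain carry a nonnegativity proof; the lemmas that follow a chain
  -- receive that of its first point as a hypothesis.
  data Linked : Vec ℤ n → Vec ℤ n → Set where
    refl-link : Linked a a
    link      : ∀ {a b c} → NonNegV b → InKer M (a ⊖ b) →
                (∃[ i ] (0ℤ < lookup a i × 0ℤ < lookup b i)) → Linked b c → Linked a c

-- Minimal Markov bases

-- Connection by `R` together with at most one passage through an extra undirected edge between `p`
-- and `q`. One formula serves both decidable reachability and the exchange argument.
Via : {A : Set} (R : A → A → Set) → A → A → A → A → Set
Via R p q a b = R a b ⊎ (R a p × R q b) ⊎ (R a q × R p b)

module _ {A : Set} {R : A → A → Set} {p q : A} where

  -- Two passages in the same direction can be shortened to one, and two in opposite directions
  -- cancel.
  via-trans : (∀ {x y z} → R x y → R y z → R x z) →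
    ∀ {a b c} → Via R p q a b → Via R p q b c → Via R p q a c
  via-trans _∙_ (inj₁ ab)               (inj₁ bc)               = inj₁ (ab ∙ bc)
  via-trans _∙_ (inj₁ ab)               (inj₂ (inj₁ (bp , qc))) = inj₂ (inj₁ (ab ∙ bp , qc))
  via-trans _∙_ (inj₁ ab)               (inj₂ (inj₂ (bq , pc))) = inj₂ (inj₂ (ab ∙ bq , pc))
  via-trans _∙_ (inj₂ (inj₁ (ap , qb))) (inj₁ bc)               = inj₂ (inj₁ (ap , qb ∙ bc))
  via-trans _∙_ (inj₂ (inj₁ (ap , _)))  (inj₂ (inj₁ (_ , qc)))  = inj₂ (inj₁ (ap , qc))
  via-trans _∙_ (inj₂ (inj₁ (ap , _)))  (inj₂ (inj₂ (_ , pc)))  = inj₁ (ap ∙ pc)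
  via-trans _∙_ (inj₂ (inj₂ (aq , pb))) (inj₁ bc)               = inj₂ (inj₂ (aq , pb ∙ bc))
  via-trans _∙_ (inj₂ (inj₂ (aq , _)))  (inj₂ (inj₁ (_ , qc)))  = inj₁ (aq ∙ qc)
  via-trans _∙_ (inj₂ (inj₂ (aq , _)))  (inj₂ (inj₂ (_ , pc)))  = inj₂ (inj₂ (aq , pc))

  via-sym : (∀ {x y} → R x y → R y x) → ∀ {a b} → Via R p q a b → Via R p q b a
  via-sym sy (inj₁ ab)               = inj₁ (sy ab)
  via-sym sy (inj₂ (inj₁ (ap , qb))) = inj₂ (inj₂ (sy qb , sy ap))
  via-sym sy (inj₂ (inj₂ (aq , pb))) = inj₂ (inj₁ (sy pb , sy aq))

module _ {A : Set} where

  -- Connectivity in a finite undirected graph, one edge at a time, so that it is decidable by recursion.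
  Reach : List (A × A) → A → A → Set
  Reach []            a b = a ≡ b
  Reach ((p , q) ∷ E) a b = Via (Reach E) p q a b

  reach-refl : ∀ E {a} → Reach E a a
  reach-refl []      = refl
  reach-refl (_ ∷ E) = inj₁ (reach-refl E)

  reach-sym : ∀ E {a b} → Reach E a b → Reach E b a
  reach-sym []            = sym
  reach-sym ((p , q) ∷ E) = via-sym {R = Reach E} (reach-sym E)

  reach-trans : ∀ E {a b c} → Reach E a b → Reach E b c → Reach E a c
  reach-trans []            = trans
  reach-trans ((p , q) ∷ E) = via-trans {R = Reach E} (reach-trans E)

  reach-edge : ∀ {E p q} → (p , q) LM.∈ E → Reach E p q
  reach-edge {E = _ ∷ E} (here refl) = inj₂ (inj₁ (reach-refl E , reach-refl E))
  reach-edge (there e) = inj₁ (reach-edge e)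

  reach? : (∀ (x y : A) → Dec (x ≡ y)) → ∀ E a b → Dec (Reach E a b)
  reach? _≟_ []            a b = a ≟ b
  reach? _≟_ ((p , q) ∷ E) a b =
    reach? _≟_ E a b ⊎-dec (reach? _≟_ E a p ×-dec reach? _≟_ E q b)
                     ⊎-dec (reach? _≟_ E a q ×-dec reach? _≟_ E p b)

  -- Each edge is required in both directions in place of symmetry of `R`: `Walk L` can be reversed
  -- only when its starting point is nonnegative.
  reach-least : ∀ {R : A → A → Set} → (∀ {x} → R x x) → (∀ {x y z} → R x y → R y z → R x z) →
    ∀ E → (∀ {p q} → (p , q) LM.∈ E → R p q × R q p) → ∀ {a b} → Reach E a b → R a b
  reach-least rf tr []      f refl = rf
  reach-least rf tr (e ∷ E) f (inj₁ ab) = reach-least rf tr E (f ∘ there) ab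
  reach-least rf tr (e ∷ E) f (inj₂ (inj₁ (ap , qb))) =
    tr (reach-least rf tr E (f ∘ there) ap) (tr (proj₁ (f (here refl))) (reach-least rf tr E (f ∘ there) qb))
  reach-least rf tr (e ∷ E) f (inj₂ (inj₂ (aq , pb))) =
    tr (reach-least rf tr E (f ∘ there) aq) (tr (proj₂ (f (here refl))) (reach-least rf tr E (f ∘ there) pb))

box : ∀ k → ℕ → List (Vec ℕ k)
box zero    δ = [] ∷ []
box (suc k) δ = cartesianProductWith _∷_ (upTo (suc δ)) (box k δ)

∈-box : ∀ {k δ} (x : Vec ℕ k) → (∀ i → lookup x i ℕ.≤ δ) → x LM.∈ box k δ
∈-box []      h = here refl
∈-box (j ∷ x) h = ∈-cartesianProductWith⁺ _∷_ (∈-upTo⁺ (ℕ.s≤s (h Fin.zero))) (∈-box x (h ∘ Fin.suc))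

nonneg? : ∀ (x : Vec ℤ n) → Dec (NonNegV x)
nonneg? x = all? (λ i → 0ℤ ℤP.≤? lookup x i)

∈-points : ∀ {δ} {x : Vec ℤ n} → NonNegV x → (∀ i → lookup x i ≤ + δ) → x LM.∈ List.map toℤV (box n δ)
∈-points {δ = δ} {x} x≥0 x≤δ =
  subst (LM._∈ List.map toℤV (box _ δ)) (abs-toℤV x x≥0) (∈-map⁺ toℤV (∈-box (map ∣_∣ x) small))
  where
  small : ∀ i → lookup (map ∣_∣ x) i ℕ.≤ δ
  small i rewrite lookup-map i ∣_∣ x = ℤ.drop‿+≤+ (subst (_≤ + δ) (sym (ℤP.0≤i⇒+∣i∣≡i (x≥0 i))) (x≤δ i))

module Minimal {m n : ℕ} (M : Mat m n) (homogeneous : Homogeneous M) where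
  open Graded M homogeneous public

  -- A move applicable at `a` has weight at most the degree of `a`, and the degree is constant along
  -- a walk. So neither `x` nor its negative can have been used.
  avoid : ∀ {x} → All (InKer M) L → NonNegV a → total a < weight x → Walk L a b → Walk (remove x L) a b
  avoid kL ha lt done = done
  avoid {a = a} {x = x} kL ha lt (step v v∈L nn p) =
    step v (kept v∈L) nn (avoid kL nn (subst (_< weight x) (sym (total-step {v = v} {a} (ker± kL v∈L))) lt) p)
    where
    light : weight v < weight x
    light = ℤP.≤-<-trans (weight-≤-total {a = a} {v} ha nn) lt
    kept : v ∈± _ → v ∈± _
    kept (inj₁ i) = inj₁ (∈-remove⁺ i λ v≡x → ℤP.<-irrefl (cong weight v≡x) light)
    kept (inj₂ i) = inj₂ (∈-remove⁺ i λ v≡x →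
      ℤP.<-irrefl (trans (sym (weight-negV (ker± kL v∈L))) (cong weight v≡x)) light)

  shed : ∀ {x} → IsMarkovBasis M L → NonNegV a → total a ≡ weight x → Linked a b → Walk (remove x L) a b
  shed mb ha tot refl-link = done
  shed {L = L} {x = x} mb ha tot (link {a = a} {b} hb k (i , 0<ai , 0<bi) rest) =
    walk-trans first (shed mb hb (trans (sym (total-invariant {a = a} {b} k)) tot) rest)
    where
    e : Vec ℤ n
    e = unitV i
    e-below : ∀ u → NonNegV u → 0ℤ < lookup u i → NonNegV (u ⊖ e)
    e-below u hu 0<ui = ⊖-nonneg {a = u} {e} (unitV-≤ hu (ℤP.i<j⇒suc[i]≤j 0<ui))
    -- Removing one unit brings the degree strictly below `weight x`, as `avoid` requires; the unit
    -- is added back afterwards by translation.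
    drop : total (a ⊖ e) < weight x
    drop = subst₂ _<_ (sym (total-⊖ a e)) (trans (ℤP.+-identityʳ (total a)) tot)
      (ℤP.+-monoʳ-< (total a) (ℤP.neg-mono-< (subst (0ℤ <_) (sym (unitV-total i)) (+<+ (ℕ.s≤s ℕ.z≤n)))))
    k′ : InKer M ((a ⊖ e) ⊖ (b ⊖ e))
    k′ = subst (InKer M) (trans (cong₂ _⊖_ (sym (⊖-⊕-cancel a e)) (sym (⊖-⊕-cancel b e))) (⊖-translate (a ⊖ e) (b ⊖ e) e)) k
    first : Walk (remove x L) a b
    first = subst₂ (Walk _) (⊖-⊕-cancel a e) (⊖-⊕-cancel b e)
      (walk-translate (unitV-nonneg i) (avoid (proj₁ mb) (e-below a ha 0<ai) drop
        (markov-walk {M = M} mb (e-below a ha 0<ai) (e-below b hb 0<bi) k′)))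

  -- Whichever of ±v is in the basis could be crossed by the remaining elements; deleting it would
  -- leave a Markov basis, against minimality.
  umb⇒unlinked : InUniversalMarkovBasis M v → ¬ Linked (posV v) (posV (negV v))
  umb⇒unlinked {v = v} (L , (mb , minimal) , v∈L) linked = redundant v∈L
    where
    dispensable : ∀ {x} → x LM.∈ L → ¬ Crossable (remove x L) x
    dispensable {x} x∈L cr = minimal (remove x L)
      (All.tabulate λ i → proj₁ (∈-remove⁻ {L = L} i))
      (x , x∈L , λ i → proj₂ (∈-remove⁻ {L = L} i) refl)
      ( All.tabulate (λ i → All.lookup (proj₁ mb) (proj₁ (∈-remove⁻ {L = L} i)))
      , λ w u k → refine crossable (toℤV-nonneg w) (proj₂ mb w u k))
      where
      crossable : ∀ {y} → y LM.∈ L → Crossable (remove x L) y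
      crossable {y} y∈L with y ≟V x
      ... | yes refl = cr
      ... | no y≢x   = self-crossable (∈-remove⁺ y∈L y≢x)
    redundant : v ∈± L → ⊥
    redundant (inj₁ i) = dispensable i (shed mb (posV-nonneg v) refl linked)
    redundant (inj₂ i) = dispensable i
      (crossable-negV (shed mb (posV-nonneg v) (sym (weight-negV (ker± (proj₁ mb) (inj₂ i)))) linked))

  -- In degree at most `weight y` tightness allows `y` to be used only between its own two parts, so
  -- it acts as one extra edge on the walks over `S`.
  edge-split : ∀ {y} → All (InKer M) L → (∀ {v} → v LM.∈ L → v ≡ y ⊎ v LM.∈ S) →
    NonNegV a → total a ≤ weight y → Walk L a b → Via (Walk S) (posV y) (posV (negV y)) a b
  edge-split kL f ha le done = inj₁ done
  edge-split {S = S} {a = a} {y = y} kL f ha le (step v v∈L nn p) =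
    via-trans {R = Walk S} walk-trans (first v∈L)
      (edge-split kL f nn (subst (_≤ weight y) (sym (total-step {v = v} {a} (ker± kL v∈L))) le) p)
    where
    tight-edge : ∀ {v} → NonNegV (a ⊖ v) → total a ≤ weight v → a ≡ posV v × a ⊖ v ≡ posV (negV v)
    tight-edge {v} nn le = tight-source {a = a} {v} ha nn le , tight-target {a = a} {v} ha nn le
    first : v ∈± _ → Via (Walk S) (posV y) (posV (negV y)) a (a ⊖ v)
    first (inj₁ i) with f i
    ... | inj₂ v∈S  = inj₁ (step v (inj₁ v∈S) nn done)
    ... | inj₁ refl with a≡ , a′≡ ← tight-edge {v} nn le =
      inj₂ (inj₁ (subst (Walk S a) a≡ done , subst (Walk S (posV (negV v))) (sym a′≡) done))
    first (inj₂ i) with f i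
    ... | inj₂ v∈S  = inj₁ (step v (inj₂ v∈S) nn done)
    ... | inj₁ refl
      with a≡ , a′≡ ← tight-edge {v} nn (ℤP.≤-trans le (ℤP.≤-reflexive (weight-negV (ker± kL (inj₂ i))))) =
      inj₂ (inj₂ ( subst (Walk S a) (trans a≡ (cong posV (sym (negV-involutive v)))) done
                 , subst (Walk S (posV (negV v))) (sym a′≡) done))

  -- The forest condition of Kruskal's algorithm, latest element first: weights never decrease as
  -- elements are added, and each new element joins two parts not yet joined.
  data Independent : List (Vec ℤ n) → Set where
    []  : Independent []
    add : ∀ {y K} → InKer M y → All (λ x → weight x ≤ weight y) K → ¬ Crossable K y →
          Independent K → Independent (y ∷ K)

  independent-ker : Independent L → All (InKer M) L
  independent-ker []              = []
  independent-ker (add ky _ _ ind) = ky ∷ independent-ker ind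

  -- The exchange argument of Kruskal's algorithm: crossing x through a later y of at least the same weight
  -- uses y as an edge of the fibre, and would close a cycle through x that makes y crossable before it was added.
  independent⇒essential : ∀ {x K} → Independent K → x LM.∈ K → (∀ {v} → v LM.∈ S → v LM.∈ K) →
    ¬ (x LM.∈ S) → ¬ Crossable S x
  independent⇒essential {S = S} (add {K = K} _ _ ¬cr _) (here refl) S⊆K x∉S cr = ¬cr (walk-mono below cr)
    where
    below : ∀ {v} → v LM.∈ S → v LM.∈ K
    below i with S⊆K i
    ... | here refl = ⊥-elim (x∉S i)
    ... | there j   = j
  independent⇒essential {S = S} {x = x} (add {y} {K} ky le ¬cr ind) (there x∈K) S⊆K x∉S cr =
    cases (edge-split kS classify (posV-nonneg x) (All.lookup le x∈K) cr)
    where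
    kS : All (InKer M) S
    kS = All.tabulate λ i → All.lookup (ky ∷ independent-ker ind) (S⊆K i)
    S′ : List (Vec ℤ n)
    S′ = remove y S
    classify : ∀ {v} → v LM.∈ S → v ≡ y ⊎ v LM.∈ S′
    classify {v} i with v ≟V y
    ... | yes v≡y = inj₁ v≡y
    ... | no v≢y  = inj₂ (∈-remove⁺ i v≢y)
    S′⊆K : ∀ {v} → v LM.∈ S′ → v LM.∈ K
    S′⊆K i with ∈-remove⁻ {L = S} i
    ... | i′ , v≢y with S⊆K i′
    ... | here v≡y = ⊥-elim (v≢y v≡y)
    ... | there j  = j
    x→ : Crossable K x
    x→ = self-crossable x∈K
    cases : Via (Walk S′) (posV y) (posV (negV y)) (posV x) (posV (negV x)) → ⊥
    cases (inj₁ w) =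
      independent⇒essential ind x∈K S′⊆K (λ i → x∉S (proj₁ (∈-remove⁻ {L = S} i))) w
    cases (inj₂ (inj₁ (x⁺y⁺ , y⁻x⁻))) =
      ¬cr (walk-trans (walk-sym (posV-nonneg x) (walk-mono S′⊆K x⁺y⁺))
          (walk-trans x→ (walk-sym (posV-nonneg (negV y)) (walk-mono S′⊆K y⁻x⁻))))
    cases (inj₂ (inj₂ (x⁺y⁻ , y⁺x⁻))) =
      ¬cr (walk-trans (walk-mono S′⊆K y⁺x⁻)
          (walk-trans (walk-sym (posV-nonneg x) x→) (walk-mono S′⊆K x⁺y⁻)))

  module _ {L : List (Vec ℤ n)} {a : Vec ℤ n} (kL : All (InKer M) L) (ha : NonNegV a) where

    private
      points : List (Vec ℤ n)
      points = List.map toℤV (box n ∣ total a ∣)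

      edge : Vec ℤ n → Vec ℤ n → Vec ℤ n × Vec ℤ n
      edge v x = x , x ⊖ v

      -- The box also holds points of other degrees. This is harmless: every listed edge is a
      -- genuine move, and all moves in the degree of `a` are listed.
      edges : List (Vec ℤ n × Vec ℤ n)
      edges = filter (λ e → nonneg? (proj₂ e)) (cartesianProductWith edge L points)

      ∈-fibre : NonNegV w → total w ≡ total a → w LM.∈ points
      ∈-fibre {w} w≥0 eq = ∈-points w≥0 λ i →
        subst (lookup w i ≤_) (trans eq (sym (ℤP.0≤i⇒+∣i∣≡i (sum-nonneg ha)))) (term≤sum w≥0 i)

      ∈-edges : v LM.∈ L → NonNegV w → total w ≡ total a → NonNegV (w ⊖ v) → (w , w ⊖ v) LM.∈ edges
      ∈-edges v∈L hw eq nn = ∈-filter⁺ (λ e → nonneg? (proj₂ e))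
        (∈-cartesianProductWith⁺ edge v∈L (∈-fibre hw eq)) nn

      edges-walk : ∀ {p q} → (p , q) LM.∈ edges → Walk L p q × Walk L q p
      edges-walk e with ∈-filter⁻ (λ e → nonneg? (proj₂ e)) {xs = cartesianProductWith edge L points} e
      ... | e′ , nn with ∈-cartesianProductWith⁻ edge L points e′
      ... | v , x , v∈L , x∈ , refl with ∈-map⁻ toℤV x∈
      ... | x′ , _ , refl = forth , walk-sym (toℤV-nonneg x′) forth
        where
        forth : Walk L (toℤV x′) (toℤV x′ ⊖ v)
        forth = step v (inj₁ v∈L) nn done

      reach-complete : NonNegV w → total w ≡ total a → Walk L w b → Reach edges w b
      reach-complete hw eq done = reach-refl edges
      reach-complete {w} hw eq (step v v∈L nn p) =
        reach-trans edges (first v∈L) (reach-complete nn eq′ p)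
        where
        eq′ : total (w ⊖ v) ≡ total a
        eq′ = trans (total-step {v = v} {w} (ker± kL v∈L)) eq
        back : (w ⊖ v) ⊖ negV v ≡ w
        back = trans (cong ((w ⊖ v) ⊖_) (trans (cong negV (sym (⊖-⊖ w v))) (⊖-negV w (w ⊖ v)))) (⊖-⊖ (w ⊖ v) w)
        first : v ∈± L → Reach edges w (w ⊖ v)
        first (inj₁ i) = reach-edge (∈-edges i hw eq nn)
        first (inj₂ i) = subst (λ z → Reach edges z (w ⊖ v)) back
          (reach-sym edges (reach-edge (∈-edges i nn eq′ (subst NonNegV (sym back) hw))))

    -- Homogeneity bounds every coordinate along a walk by `total a`, so walking is reachability in
    -- a finite graph.
    walk? : ∀ b → Dec (Walk L a b)
    walk? b = map′ (reach-least done walk-trans edges edges-walk) (reach-complete ha refl) (reach? _≟V_ edges a b)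

  -- If `a` and `a ⊖ v` had disjoint supports, `a` would equal `posV v` and the move would have the
  -- full weight `W`. Moves of smaller weight therefore always leave a shared coordinate.
  walk⇒linked : All (InKer M) L → ∀ {W} → All (λ x → weight x < W) L →
    NonNegV a → total a ≡ W → Walk L a b → Linked a b
  walk⇒linked kL lt ha eq done = refl-link
  walk⇒linked {L = L} {a = a} kL {W} lt ha eq (step v v∈L nn p)
    with any? (λ i → (0ℤ ℤP.<? lookup a i) ×-dec (0ℤ ℤP.<? lookup (a ⊖ v) i))
  ... | yes shared = link nn (subst (InKer M) (sym (⊖-⊖ a v)) (ker± kL v∈L)) shared
    (walk⇒linked kL lt nn (trans (total-step {v = v} {a} (ker± kL v∈L)) eq) p)
  ... | no disjoint = ⊥-elim (ℤP.<-irrefl (trans (sum-cong-≗ (sym ∘ pointwise)) eq) (light v∈L))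
    where
    light : v ∈± L → weight v < W
    light (inj₁ i) = All.lookup lt i
    light (inj₂ i) = subst (_< W) (weight-negV (ker± kL v∈L)) (All.lookup lt i)
    pointwise : ∀ i → lookup a i ≡ lookup (posV v) i
    pointwise i with 0ℤ ℤP.<? lookup a i | 0ℤ ℤP.<? lookup (a ⊖ v) i
    ... | yes p | yes q = ⊥-elim (disjoint (i , p , q))
    ... | no ¬p | _     = ℤP.≤-antisym (ℤP.≤-trans (ℤP.≮⇒≥ ¬p) (posV-nonneg v i)) (posV-least {a = a} {v} ha nn i)
    ... | yes p | no ¬q = trans a≡v (sym (trans (lookup-posV v i) (pos-of-nonneg (subst (0ℤ ≤_) a≡v (ha i)))))
      where
      a≡v : lookup a i ≡ lookup v i
      a≡v = ℤP.i-j≡0⇒i≡j _ _ (trans (sym (lookup-⊖ a v i)) (ℤP.≤-antisym (ℤP.≮⇒≥ ¬q) (nn i)))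

  <-suc : ∀ {x N} → x < + suc N → x ≤ + N
  <-suc {+ _} (+<+ (ℕ.s≤s h)) = +≤+ h
  <-suc { -[1+ _ ]} _ = -≤+

  -- The greedy pass through degree `N`: a candidate of this weight is added exactly when the
  -- current list cannot cross it. Either way it is crossable from then on, since lists only grow.
  scan : ∀ N C → All (InKer M) C → ∀ {K} → Independent K → All (λ x → weight x ≤ + N) K →
    ∃[ K′ ] (Independent K′ × All (λ x → weight x ≤ + N) K′ × (∀ {v} → v LM.∈ K → v LM.∈ K′) ×
             (∀ {v} → v LM.∈ C → weight v ≡ + N → Crossable K′ v))
  scan N [] [] {K} ind le = K , ind , le , id , λ ()
  scan N (v ∷ C) (kv ∷ kC) {K} ind le with weight v ℤ.≟ + N
  ... | no ≢N with K′ , ind′ , le′ , K⊆K′ , cr ← scan N C kC ind le =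
    K′ , ind′ , le′ , K⊆K′ , λ { (here refl) ≡N → ⊥-elim (≢N ≡N) ; (there i) → cr i }
  ... | yes ≡N with walk? (independent-ker ind) (posV-nonneg v) (posV (negV v))
  ... | yes c with K′ , ind′ , le′ , K⊆K′ , cr ← scan N C kC ind le =
    K′ , ind′ , le′ , K⊆K′ , λ { (here refl) _ → walk-mono K⊆K′ c ; (there i) → cr i }
  ... | no ¬c with K′ , ind′ , le′ , K⊆K′ , cr ← scan N C kC
                     (add kv (All.map (subst (_ ≤_) (sym ≡N)) le) ¬c ind) (ℤP.≤-reflexive ≡N ∷ le) =
    K′ , ind′ , le′ , K⊆K′ ∘ there ,
    λ { (here refl) _ → self-crossable (K⊆K′ (here refl)) ; (there i) → cr i }

  module _ {L₀ : List (Vec ℤ n)} (mb : IsMarkovBasis M L₀) {d : Vec ℤ n} (kd : InKer M d)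
           (unlinked : ¬ Linked (posV d) (posV (negV d))) where

    private
      -- The invariant once all degrees below `N` are settled: what has been chosen is independent,
      -- crosses every lighter element of `L₀`, and includes `d` as soon as its degree has passed.
      Level : ℕ → List (Vec ℤ n) → Set
      Level N K = Independent K × All (λ x → weight x < + N) K × (weight d < + N → d LM.∈ K) ×
                  (∀ {v} → v LM.∈ L₀ → weight v < + N → Crossable K v)

      level : ∀ N → ∃ (Level N)
      level zero = [] , [] , [] , (λ lt → ⊥-elim (ℤP.<⇒≱ lt (0≤weight d))) ,
        λ {v} _ lt → ⊥-elim (ℤP.<⇒≱ lt (0≤weight v))
      level (suc N) with K , ind , lt , d∈ , cr ← level N = next insert-d
        where
        Extension : List (Vec ℤ n) → Set
        Extension K₁ = Independent K₁ × All (λ x → weight x ≤ + N) K₁ × (weight d < + suc N → d LM.∈ K₁) ×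
                       (∀ {v} → v LM.∈ K → v LM.∈ K₁)
        le : All (λ x → weight x ≤ + N) K
        le = All.map ℤP.<⇒≤ lt
        insert-d : ∃ Extension
        insert-d with weight d ℤ.≟ + N
        -- At this moment every element of `K` is lighter than `d`, so a walk between its parts
        -- would be a chain of linked points. Once other elements of the same degree were present,
        -- this conclusion would no longer be available.
        ... | yes eq = d ∷ K ,
          add kd (All.map (subst (_ ≤_) (sym eq)) le)
            (unlinked ∘ walk⇒linked (independent-ker ind) lt (posV-nonneg d) eq) ind ,
          ℤP.≤-reflexive eq ∷ le , (λ _ → here refl) , there
        ... | no neq = K , ind , le , (λ h → d∈ (ℤP.≤∧≢⇒< (<-suc h) neq)) , id
        next : ∃ Extension → ∃ (Level (suc N))
        next (K₁ , ind₁ , le₁ , d∈₁ , K⊆K₁)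
          with K₂ , ind₂ , le₂ , K₁⊆K₂ , cr₂ ← scan N L₀ (proj₁ mb) ind₁ le₁ =
          K₂ , ind₂ , All.map (λ h → ℤP.≤-<-trans h (+<+ ℕP.≤-refl)) le₂ , K₁⊆K₂ ∘ d∈₁ , crossable
          where
          crossable : ∀ {v} → v LM.∈ L₀ → weight v < + suc N → Crossable K₂ v
          crossable {v} i h with weight v ℤ.≟ + N
          ... | yes eq = cr₂ i eq
          ... | no neq = walk-mono (K₁⊆K₂ ∘ K⊆K₁) (cr i (ℤP.≤∧≢⇒< (<-suc h) neq))

      bound : ∀ (L : List (Vec ℤ n)) → ∃[ N ] All (λ v → weight v < + N) L
      bound []      = 0 , []
      bound (v ∷ L) with N , lt ← bound L =
        suc ∣ weight v ∣ ℕ.⊔ N ,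
        ℤP.<-≤-trans (subst (_< + suc ∣ weight v ∣) (ℤP.0≤i⇒+∣i∣≡i (0≤weight v)) (+<+ ℕP.≤-refl))
          (+≤+ (ℕP.m≤m⊔n (suc ∣ weight v ∣) N)) ∷
        All.map (λ h → ℤP.<-≤-trans h (+≤+ (ℕP.m≤n⊔m (suc ∣ weight v ∣) N))) lt

    -- Beyond all weights of `d` and `L₀` the chosen list crosses all of `L₀`, hence is a Markov
    -- basis by `refine`; independence makes each of its elements essential.
    unlinked⇒umb : InUniversalMarkovBasis M d
    unlinked⇒umb with N , d< ∷ lt ← bound (d ∷ L₀) with K , ind , _ , d∈ , cr ← level N =
      K ,
      ( ( independent-ker ind
        , λ w u k → refine (λ i → cr i (All.lookup lt i)) (toℤV-nonneg w) (proj₂ mb w u k))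
      , λ S S⊆K (x , x∈K , x∉S) mbS → independent⇒essential ind x∈K (All.lookup S⊆K) x∉S
          (markov-walk {M = M} mbS (posV-nonneg x) (posV-nonneg (negV x))
            (subst (InKer M) (sym (posV-split x)) (All.lookup (independent-ker ind) x∈K))))
      , inj₁ (d∈ d<)

-- Existence of finite Markov bases

infixr 7 _⊙_
_⊙_ : ℤ → Vec ℤ n → Vec ℤ n
c ⊙ v = map (c *_) v

lookup-⊙ : ∀ c (v : Vec ℤ n) i → lookup (c ⊙ v) i ≡ c * lookup v i
lookup-⊙ c v i = lookup-map i (c *_) v

dot-⊙ : ∀ (r : Vec ℤ n) c v → dot r (c ⊙ v) ≡ c * dot r v
dot-⊙ []      c []      = sym (ℤP.*-zeroʳ c)
dot-⊙ (x ∷ r) c (y ∷ v) = trans (cong (_+_ (x * (c * y))) (dot-⊙ r c v)) (expand x c y (dot r v))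
  where
  expand : ∀ x c y s → x * (c * y) + c * s ≡ c * (x * y + s)
  expand = solve-∀

dot-negˡ : ∀ (r v : Vec ℤ n) → dot (negV r) v ≡ - dot r v
dot-negˡ []      []      = refl
dot-negˡ (x ∷ r) (y ∷ v) = trans (cong (_+_ (- x * y)) (dot-negˡ r v)) (expand x y (dot r v))
  where
  expand : ∀ x y s → - x * y + - s ≡ - (x * y + s)
  expand = solve-∀

-- Membership in the monoid generated by `H`, expressed by taking summands away, so that proofs can
-- descend from `x`.
data Gen (H : List (Vec ℤ n)) : Vec ℤ n → Set where
  none : Gen H zeroV
  add  : ∀ {x} h → h LM.∈ H → Gen H (x ⊖ h) → Gen H x

⊖-self : ∀ (x : Vec ℤ n) → x ⊖ x ≡ zeroV
⊖-self x = vec-ext λ i → trans (lookup-⊖ x x i) (trans (ℤP.+-inverseʳ (lookup x i)) (sym (lookup-zeroV i)))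

gen-single : ∀ {H} {x : Vec ℤ n} → x LM.∈ H → Gen H x
gen-single {x = x} x∈H = add x x∈H (subst (Gen _) (sym (⊖-self x)) none)

0≤abs : ∀ x → 0ℤ ≤ + ∣ x ∣
0≤abs x = +≤+ ℕ.z≤n

-- Nonnegative solutions of one linear equation

module SingleEquation (b : Vec ℤ k) where

  B : ℤ
  B = sum (λ j → + ∣ lookup b j ∣)

  0≤B : 0ℤ ≤ B
  0≤B = sum-nonneg (λ j → 0≤abs (lookup b j))

  -- The bound has to dominate three quantities: 1, for unit vectors at zero coefficients; `B`, for
  -- the entries of two-term solutions; and `B * B`, above which a coordinate forces a large one at
  -- a coefficient of opposite sign.
  K : ℤ
  K = 1ℤ + B + B * B

  1≤K : 1ℤ ≤ K
  1≤K = ≤-from-gap (0≤B ⟨+⟩ 0≤* 0≤B 0≤B) (ℤP.+-assoc 1ℤ B (B * B))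

  0≤K : 0ℤ ≤ K
  0≤K = ℤP.≤-trans (+≤+ ℕ.z≤n) 1≤K

  B≤K : B ≤ K
  B≤K = ≤-from-gap {c = 1ℤ + B * B} (+≤+ {0} {1} ℕ.z≤n ⟨+⟩ 0≤* 0≤B 0≤B) (shuffle B (B * B))
    where
    shuffle : ∀ x y → 1ℤ + x + y ≡ x + (1ℤ + y)
    shuffle = solve-∀

  B²≤K : B * B ≤ K
  B²≤K = ≤-from-gap {c = 1ℤ + B} (+≤+ {0} {1} ℕ.z≤n ⟨+⟩ 0≤B) (ℤP.+-comm (1ℤ + B) (B * B))

  coeff≤B : ∀ j → + ∣ lookup b j ∣ ≤ B
  coeff≤B = term≤sum (λ j → 0≤abs (lookup b j))

  generators : List (Vec ℤ k)
  generators = filter (λ g → dot b g ℤ.≟ 0ℤ) (List.map toℤV (box k ∣ K ∣))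

  -- A small nonzero solution that can be split off from `x`.
  record Part (x : Vec ℤ k) : Set where
    field
      μ       : Vec ℤ k
      μ≥0     : NonNegV μ
      μ-zero  : dot b μ ≡ 0ℤ
      μ≤x     : ∀ j → lookup μ j ≤ lookup x j
      μ≤K     : ∀ j → lookup μ j ≤ K
      0<total : 0ℤ < total μ

  ∈-generators : ∀ {g} → NonNegV g → dot b g ≡ 0ℤ → (∀ j → lookup g j ≤ K) → g LM.∈ generators
  ∈-generators g≥0 eq g≤K = ∈-filter⁺ (λ g → dot b g ℤ.≟ 0ℤ)
    (∈-points g≥0 λ i → subst (_ ≤_) (sym (ℤP.0≤i⇒+∣i∣≡i 0≤K)) (g≤K i)) eq

  -- A solution without large coordinates is itself a generator. Otherwise splitting off a part
  -- lowers the total, and this bounds the recursion.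
  gen : (∀ {x} → NonNegV x → dot b x ≡ 0ℤ → ∀ i → K < lookup x i → Part x) →
    ∀ N {x} → total x ≤ + N → NonNegV x → dot b x ≡ 0ℤ → Gen generators x
  gen part N {x} le x≥0 eq with any? (λ i → K ℤP.<? lookup x i)
  ... | no small = gen-single (∈-generators x≥0 eq λ j → ℤP.≮⇒≥ λ lt → small (j , lt))
  ... | yes (i , lt) = go N le
    where
    open Part (part x≥0 eq i lt)
    go : ∀ N → total x ≤ + N → Gen generators x
    go zero    le = ⊥-elim (ℤP.<⇒≱ 0<total (ℤP.≤-trans (sum-mono-≤ μ≤x) le))
    go (suc N) le = add μ (∈-generators μ≥0 μ-zero μ≤K)
      (gen part N smaller (⊖-nonneg {a = x} {μ} μ≤x) (trans (dot-⊖ b x μ) (cong₂ _-_ eq μ-zero)))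
      where
      shuffle : ∀ t m N → (1ℤ + N) - t + (m - 1ℤ) ≡ N - (t - m)
      shuffle = solve-∀
      smaller : total (x ⊖ μ) ≤ + N
      smaller = subst (_≤ + N) (sym (total-⊖ x μ))
        (ℤP.0≤i-j⇒j≤i (subst (0ℤ ≤_) (shuffle (total x) (total μ) (+ N))
          (gap le ⟨+⟩ gap (ℤP.i<j⇒suc[i]≤j 0<total))))

pair : Fin k → Fin k → ℤ → ℤ → Vec ℤ k
pair i j c d = (c ⊙ unitV i) ⊕ (d ⊙ unitV j)

module Pair (i j : Fin k) (c d : ℤ) where

  lookup-pair : ∀ t → lookup (pair i j c d) t ≡ c * lookup (unitV i) t + d * lookup (unitV j) t
  lookup-pair t = trans (lookup-⊕ (c ⊙ unitV i) _ t) (cong₂ _+_ (lookup-⊙ c (unitV i) t) (lookup-⊙ d (unitV j) t))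

  pair-≤ : ∀ {X : Fin k → ℤ} → i ≢ j → (∀ t → 0ℤ ≤ X t) → c ≤ X i → d ≤ X j → ∀ t → lookup (pair i j c d) t ≤ X t
  pair-≤ {X} i≢j X≥0 c≤ d≤ t = subst (_≤ X t) (sym (lookup-pair t)) bound
    where
    bound : c * lookup (unitV i) t + d * lookup (unitV j) t ≤ X t
    bound with i Fin.≟ t | j Fin.≟ t
    ... | yes refl | yes refl = ⊥-elim (i≢j refl)
    ... | yes refl | no j≢t rewrite unitV-self i | unitV-other j≢t = subst (_≤ X i) (sym (simplify c d)) c≤
      where
      simplify : ∀ c d → c * 1ℤ + d * 0ℤ ≡ c
      simplify = solve-∀
    ... | no i≢t | yes refl rewrite unitV-self j | unitV-other i≢t = subst (_≤ X j) (sym (simplify c d)) d≤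
      where
      simplify : ∀ c d → c * 0ℤ + d * 1ℤ ≡ d
      simplify = solve-∀
    ... | no i≢t | no j≢t rewrite unitV-other i≢t | unitV-other j≢t = subst (_≤ X t) (sym (simplify c d)) (X≥0 t)
      where
      simplify : ∀ c d → c * 0ℤ + d * 0ℤ ≡ 0ℤ
      simplify = solve-∀

  pair-≥0 : 0ℤ ≤ c → 0ℤ ≤ d → NonNegV (pair i j c d)
  pair-≥0 0≤c 0≤d t = subst (0ℤ ≤_) (sym (lookup-pair t)) (0≤* 0≤c (unitV-nonneg i t) ⟨+⟩ 0≤* 0≤d (unitV-nonneg j t))

  pair-at : i ≢ j → lookup (pair i j c d) i ≡ c
  pair-at i≢j = trans (lookup-pair i)
    (trans (cong₂ (λ x y → c * x + d * y) (unitV-self i) (unitV-other (i≢j ∘ sym))) (simplify c d))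
    where
    simplify : ∀ c d → c * 1ℤ + d * 0ℤ ≡ c
    simplify = solve-∀

  dot-pair : ∀ b → dot b (pair i j c d) ≡ c * lookup b i + d * lookup b j
  dot-pair b = trans (dot-⊕ b (c ⊙ unitV i) (d ⊙ unitV j))
    (cong₂ _+_ (trans (dot-⊙ b c (unitV i)) (cong (c *_) (dot-unitV b i)))
               (trans (dot-⊙ b d (unitV j)) (cong (d *_) (dot-unitV b j))))

module _ (b : Vec ℤ k) where
  open SingleEquation b

  -- If no coordinate of opposite sign reached B, the term at i alone would outweigh all negative terms.
  opposite : ∀ {x} → NonNegV x → dot b x ≡ 0ℤ → ∀ i → 0ℤ < lookup b i → B * B < lookup x i →
    ∃[ j ] (lookup b j < 0ℤ × B ≤ lookup x j)
  opposite {x} x≥0 eq i 0<bi big with any? (λ j → (lookup b j ℤP.<? 0ℤ) ×-dec (B ℤP.≤? lookup x j))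
  ... | yes found = found
  ... | no absent = ⊥-elim (ℤP.<⇒≱ big (ℤP.≤-trans xi≤ (ℤP.≤-trans (term≤sum shifted≥0 i) (ℤP.≤-reflexive shifted-sum))))
    where
    -- Where b_j is negative, x_j is below `B`, so the shift by |b_j|B makes every term nonnegative;
    -- it raises the sum from 0 to exactly B². As b_i is at least 1, x_i is bounded by its own term.
    shifted : Fin k → ℤ
    shifted j = lookup b j * lookup x j + + ∣ lookup b j ∣ * B
    shifted≥0 : ∀ j → 0ℤ ≤ shifted j
    shifted≥0 j with lookup b j | (λ p q → absent (j , p , q))
    ... | + n      | _    = 0≤* {+ n} (+≤+ ℕ.z≤n) (x≥0 j) ⟨+⟩ 0≤* {+ n} (+≤+ ℕ.z≤n) 0≤B
    ... | -[1+ n ] | refute = subst (0ℤ ≤_) (factor (+ suc n) (lookup x j) B)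
      (0≤* {+ suc n} (+≤+ ℕ.z≤n) (gap (ℤP.<⇒≤ (ℤP.≰⇒> (refute ℤ.-<+)))))
      where
      factor : ∀ c x B → c * (B - x) ≡ - c * x + c * B
      factor = solve-∀
    shifted-sum : sum shifted ≡ B * B
    shifted-sum = trans (∑-distrib-+ (λ j → lookup b j * lookup x j) (λ j → + ∣ lookup b j ∣ * B))
      (trans (cong₂ _+_ (trans (sym (dot-sum b x)) eq) (sym (*-distribʳ-sum B (λ j → + ∣ lookup b j ∣))))
             (ℤP.+-identityˡ (B * B)))
    xi≤ : lookup x i ≤ shifted i
    xi≤ = ≤-from-gap {c = (lookup b i - 1ℤ) * lookup x i + + ∣ lookup b i ∣ * B}
      (0≤* (gap (ℤP.i<j⇒suc[i]≤j 0<bi)) (x≥0 i) ⟨+⟩ 0≤* (0≤abs (lookup b i)) 0≤B)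
      (regroup (lookup b i) (lookup x i) (+ ∣ lookup b i ∣ * B))
      where
      regroup : ∀ b x c → b * x + c ≡ x + ((b - 1ℤ) * x + c)
      regroup = solve-∀

  -- Two coefficients of opposite sign carry the solution with entries -b_j at `i` and b_i at `j`.
  -- Both entries are at most `B`, and x_i and x_j are both at least `B`, so it fits below `x`.
  part⁺ : ∀ {x} → NonNegV x → dot b x ≡ 0ℤ → ∀ i → 0ℤ < lookup b i → K < lookup x i → Part x
  part⁺ {x} x≥0 eq i 0<bi big with j , bj<0 , B≤xj ← opposite x≥0 eq i 0<bi (ℤP.≤-<-trans B²≤K big) = record
    { μ       = pair i j (- lookup b j) (lookup b i)
    ; μ≥0     = μ≥0
    ; μ-zero  = trans (dot-pair b) (cancel (lookup b i) (lookup b j))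
    ; μ≤x     = pair-≤ {X = lookup x} i≢j x≥0 (ℤP.≤-trans c≤B (ℤP.≤-trans B≤K (ℤP.<⇒≤ big))) (ℤP.≤-trans d≤B B≤xj)
    ; μ≤K     = pair-≤ {X = λ _ → K} i≢j (λ _ → 0≤K) (ℤP.≤-trans c≤B B≤K) (ℤP.≤-trans d≤B B≤K)
    ; 0<total = ℤP.<-≤-trans (subst (0ℤ <_) (sym (pair-at i≢j)) 0<c)
                  (term≤sum μ≥0 i)
    }
    where
    cancel : ∀ x y → - y * x + x * y ≡ 0ℤ
    cancel = solve-∀
    0<c : 0ℤ < - lookup b j
    0<c = ℤP.neg-mono-< bj<0
    open Pair i j (- lookup b j) (lookup b i)
    μ≥0 : NonNegV (pair i j (- lookup b j) (lookup b i))
    μ≥0 = pair-≥0 (ℤP.<⇒≤ 0<c) (ℤP.<⇒≤ 0<bi)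
    i≢j : i ≢ j
    i≢j refl = ℤP.<-asym bj<0 0<bi
    ≤abs : ∀ x → x ≤ + ∣ x ∣
    ≤abs (+ _)    = ℤP.≤-refl
    ≤abs -[1+ _ ] = -≤+
    c≤B : - lookup b j ≤ B
    c≤B = ℤP.≤-trans (subst (λ z → - lookup b j ≤ + z) (ℤP.∣-i∣≡∣i∣ (lookup b j)) (≤abs (- lookup b j))) (coeff≤B j)
    d≤B : lookup b i ≤ B
    d≤B = ℤP.≤-trans (≤abs (lookup b i)) (coeff≤B i)

B-negV : ∀ (b : Vec ℤ k) → SingleEquation.B (negV b) ≡ SingleEquation.B b
B-negV b = sum-cong-≗ λ j → cong +_ (trans (cong ∣_∣ (lookup-negV b j)) (ℤP.∣-i∣≡∣i∣ (lookup b j)))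

K-negV : ∀ (b : Vec ℤ k) → SingleEquation.K (negV b) ≡ SingleEquation.K b
K-negV b = cong (λ B → 1ℤ + B + B * B) (B-negV b)

module _ (b : Vec ℤ k) where
  open SingleEquation b

  part : ∀ {x} → NonNegV x → dot b x ≡ 0ℤ → ∀ i → K < lookup x i → Part x
  part {x} x≥0 eq i big with ℤP.<-cmp 0ℤ (lookup b i)
  ... | tri< 0<bi _ _ = part⁺ b x≥0 eq i 0<bi big
  ... | tri≈ _ 0≡bi _ = record
    { μ       = unitV i
    ; μ≥0     = unitV-nonneg i
    ; μ-zero  = trans (dot-unitV b i) (sym 0≡bi)
    ; μ≤x     = unitV-≤ x≥0 (ℤP.≤-trans 1≤K (ℤP.<⇒≤ big))
    ; μ≤K     = unitV-≤ {i = i} (λ _ → 0≤K) 1≤K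
    ; 0<total = subst (0ℤ <_) (sym (unitV-total i)) (+<+ (ℕ.s≤s ℕ.z≤n))
    }
  -- The equation for `negV b` has the same solutions and the same bound, so this case reduces to a
  -- positive coefficient.
  ... | tri> _ _ bi<0 = record
    { μ       = P.μ
    ; μ≥0     = P.μ≥0
    ; μ-zero  = ℤP.neg-injective (trans (sym (dot-negˡ b P.μ)) P.μ-zero)
    ; μ≤x     = P.μ≤x
    ; μ≤K     = λ j → subst (lookup P.μ j ≤_) (K-negV b) (P.μ≤K j)
    ; 0<total = P.0<total
    }
    where
    module P = SingleEquation.Part
      (part⁺ (negV b) x≥0 (trans (dot-negˡ b x) (cong (-_) eq)) i
        (subst (0ℤ <_) (sym (lookup-negV b i)) (ℤP.neg-mono-< bi<0)) (subst (_< lookup x i) (sym (K-negV b)) big))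

  single-equation : ∃[ G ] (All (λ g → NonNegV g × dot b g ≡ 0ℤ) G × (∀ x → NonNegV x → dot b x ≡ 0ℤ → Gen G x))
  single-equation = generators , All.tabulate sound , λ x x≥0 →
    gen part ∣ total x ∣ (ℤP.≤-reflexive (sym (ℤP.0≤i⇒+∣i∣≡i (sum-nonneg x≥0)))) x≥0
    where
    sound : ∀ {g} → g LM.∈ generators → NonNegV g × dot b g ≡ 0ℤ
    sound g∈ with ∈-filter⁻ (λ g → dot b g ℤ.≟ 0ℤ) {xs = List.map toℤV (box k ∣ K ∣)} g∈
    ... | g∈′ , eq with ∈-map⁻ toℤV g∈′
    ... | x , _ , refl = toℤV-nonneg x , eq

-- Generators for systems of equations and for pairs in a fibre

comb : (H : List (Vec ℤ n)) → Vec ℤ (List.length H) → Vec ℤ n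
comb []      []       = zeroV
comb (h ∷ H) (c ∷ cs) = (c ⊙ h) ⊕ comb H cs

values : Vec ℤ n → (H : List (Vec ℤ n)) → Vec ℤ (List.length H)
values r []      = []
values r (h ∷ H) = dot r h ∷ values r H

dot-zeroʳ : ∀ (r : Vec ℤ n) → dot r zeroV ≡ 0ℤ
dot-zeroʳ r = trans (dot-sum r zeroV)
  (sum-zero λ j → trans (cong (lookup r j *_) (lookup-zeroV j)) (ℤP.*-zeroʳ (lookup r j)))

dot-zeroˡ : ∀ (v : Vec ℤ n) → dot zeroV v ≡ 0ℤ
dot-zeroˡ v = trans (dot-sum zeroV v)
  (sum-zero λ j → cong (_* lookup v j) (lookup-zeroV j))

dot-comb : ∀ (r : Vec ℤ n) H cs → dot r (comb H cs) ≡ dot (values r H) cs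
dot-comb r []      []       = dot-zeroʳ r
dot-comb r (h ∷ H) (c ∷ cs) = trans (dot-⊕ r (c ⊙ h) (comb H cs))
  (cong₂ _+_ (trans (dot-⊙ r c h) (ℤP.*-comm c (dot r h))) (dot-comb r H cs))

lookup-comb-∷ : ∀ (h : Vec ℤ n) H c cs i → lookup (comb (h ∷ H) (c ∷ cs)) i ≡ c * lookup h i + lookup (comb H cs) i
lookup-comb-∷ h H c cs i = trans (lookup-⊕ (c ⊙ h) (comb H cs) i) (cong (_+ lookup (comb H cs) i) (lookup-⊙ c h i))

lookup-comb-⊖ : ∀ (H : List (Vec ℤ n)) x y i →
  lookup (comb H (x ⊖ y)) i ≡ lookup (comb H x) i - lookup (comb H y) i
lookup-comb-⊖ [] [] [] i rewrite lookup-zeroV i = refl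
lookup-comb-⊖ (h ∷ H) (c ∷ x) (d ∷ y) i =
  trans (lookup-comb-∷ h H (c - d) (x ⊖ y) i)
  (trans (cong (_+_ ((c - d) * lookup h i)) (lookup-comb-⊖ H x y i))
  (trans (expand c d (lookup h i) (lookup (comb H x) i) (lookup (comb H y) i))
         (sym (cong₂ _-_ (lookup-comb-∷ h H c x i) (lookup-comb-∷ h H d y i)))))
  where
  expand : ∀ c d h s t → (c - d) * h + (s - t) ≡ (c * h + s) - (d * h + t)
  expand = solve-∀

comb-⊖ : ∀ (H : List (Vec ℤ n)) x y → comb H (x ⊖ y) ≡ comb H x ⊖ comb H y
comb-⊖ H x y = vec-ext λ i → trans (lookup-comb-⊖ H x y i) (sym (lookup-⊖ (comb H x) (comb H y) i))

comb-zero : ∀ (H : List (Vec ℤ n)) → comb H zeroV ≡ zeroV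
comb-zero H = trans (cong (comb H) (sym (⊖-self zeroV))) (trans (comb-⊖ H zeroV zeroV) (⊖-self (comb H zeroV)))

comb-nonneg : ∀ {H : List (Vec ℤ n)} → All NonNegV H → ∀ cs → NonNegV cs → NonNegV (comb H cs)
comb-nonneg []        []       _  i = subst (0ℤ ≤_) (sym (lookup-zeroV i)) ℤP.≤-refl
comb-nonneg {H = h ∷ H} (h≥0 ∷ H≥0) (c ∷ cs) p i = subst (0ℤ ≤_) (sym (lookup-comb-∷ h H c cs i))
  (0≤* (p Fin.zero) (h≥0 i) ⟨+⟩ comb-nonneg H≥0 cs (p ∘ Fin.suc) i)

bump : ∀ {H : List (Vec ℤ n)} {h} → h LM.∈ H → ∀ cs → NonNegV cs →
  ∃[ ds ] (NonNegV ds × (∀ i → lookup (comb H ds) i ≡ lookup (comb H cs) i + lookup h i))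
bump {H = h ∷ H} (here refl) (c ∷ cs) p = c + 1ℤ ∷ cs ,
  (λ { Fin.zero → p Fin.zero ⟨+⟩ +≤+ ℕ.z≤n ; (Fin.suc i) → p (Fin.suc i) }) ,
  λ i → trans (lookup-comb-∷ h H (c + 1ℤ) cs i)
    (trans (expand c (lookup h i) (lookup (comb H cs) i)) (cong (_+ lookup h i) (sym (lookup-comb-∷ h H c cs i))))
  where
  expand : ∀ c h s → (c + 1ℤ) * h + s ≡ c * h + s + h
  expand = solve-∀
bump {H = g ∷ H} {h} (there h∈H) (c ∷ cs) p with ds , q , eq ← bump h∈H cs (p ∘ Fin.suc) = c ∷ ds ,
  (λ { Fin.zero → p Fin.zero ; (Fin.suc i) → q i }) ,
  λ i → trans (lookup-comb-∷ g H c ds i) (trans (cong (_+_ (c * lookup g i)) (eq i))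
    (trans (sym (ℤP.+-assoc (c * lookup g i) (lookup (comb H cs) i) (lookup h i)))
      (cong (_+ lookup h i) (sym (lookup-comb-∷ g H c cs i)))))

gen⇒comb : ∀ {H} {x : Vec ℤ n} → Gen H x → ∃[ cs ] (NonNegV cs × comb H cs ≡ x)
gen⇒comb {H = H} none = zeroV , (λ i → subst (0ℤ ≤_) (sym (lookup-zeroV i)) ℤP.≤-refl) , comb-zero H
gen⇒comb {x = x} (add h h∈H g) with cs , p , eq ← gen⇒comb g with ds , q , eq′ ← bump h∈H cs p =
  ds , q , vec-ext λ i → trans (eq′ i) (trans (cong (λ z → lookup z i + lookup h i) eq)
    (trans (cong (_+ lookup h i) (lookup-⊖ x h i)) (cancel (lookup x i) (lookup h i))))
  where
  cancel : ∀ x h → x - h + h ≡ x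
  cancel = solve-∀

gen-comb : ∀ (H : List (Vec ℤ n)) {G cs} → Gen G cs → Gen (List.map (comb H) G) (comb H cs)
gen-comb H none = subst (Gen _) (sym (comb-zero H)) none
gen-comb H {cs = cs} (add g g∈G r) =
  add (comb H g) (∈-map⁺ (comb H) g∈G) (subst (Gen _) (comb-⊖ H cs g) (gen-comb H r))

values-zero : ∀ (r : Vec ℤ n) {H} → All (λ h → dot r h ≡ 0ℤ) H → ∀ cs → dot (values r H) cs ≡ 0ℤ
values-zero r []        []       = refl
values-zero r (eq ∷ eqs) (c ∷ cs) = cong₂ (λ x y → x * c + y) eq (values-zero r eqs cs)

HilbertBasis : Mat m n → List (Vec ℤ n) → Set
HilbertBasis M H = All (λ h → NonNegV h × InKer M h) H × (∀ x → NonNegV x → InKer M x → Gen H x)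

-- Induction on the rows. In terms of coefficients over the generators `H` of the earlier rows, a
-- new row is a single equation with coefficients `values r H`; `comb H` maps its generators to
-- those sought.
hilbertBasis : ∀ (M : Mat m n) → ∃ (HilbertBasis M)
-- With no rows, the equation with zero coefficients supplies generators of all nonnegative vectors.
hilbertBasis [] with G , sound , complete ← single-equation zeroV =
  G , All.map (λ { (g≥0 , _) → g≥0 , refl }) sound , λ x x≥0 _ → complete x x≥0 (dot-zeroˡ x)
hilbertBasis (r ∷ M) with H , soundH , completeH ← hilbertBasis M
  with G , soundG , completeG ← single-equation (values r H) =
  List.map (comb H) G , All.tabulate sound , complete
  where
  sound : ∀ {h} → h LM.∈ List.map (comb H) G → NonNegV h × InKer (r ∷ M) h
  sound h∈ with cs , cs∈G , refl ← ∈-map⁻ (comb H) h∈ with cs≥0 , eq ← All.lookup soundG cs∈G =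
    comb-nonneg (All.map proj₁ soundH) cs cs≥0 ,
    cong₂ _∷_ (trans (dot-comb r H cs) eq)
      (inKer⁺ {M = M} λ i → trans (dot-comb (lookup M i) H cs)
        (values-zero (lookup M i) (All.map (λ p → inKer⁻ {M = M} (proj₂ p) i) soundH) cs))
  complete : ∀ x → NonNegV x → InKer (r ∷ M) x → Gen (List.map (comb H) G) x
  complete x x≥0 k with cs , cs≥0 , refl ← gen⇒comb (completeH x x≥0 (∷-injectiveʳ k)) =
    gen-comb H (completeG cs cs≥0 (trans (sym (dot-comb r H cs)) (∷-injectiveˡ k)))

module Double (n : ℕ) where

  left : Vec ℤ (n ℕ.+ n) → Vec ℤ n
  left z = tabulate (λ i → lookup z (i Fin.↑ˡ n))

  right : Vec ℤ (n ℕ.+ n) → Vec ℤ n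
  right z = tabulate (λ i → lookup z (n Fin.↑ʳ i))

  -- The nonnegative kernel vectors of the block matrix [M | -M] are precisely the pairs of points
  -- in a common fibre of `M`.
  double : Mat m n → Mat m (n ℕ.+ n)
  double = map (λ r → r Vec.++ negV r)

  dot-double : ∀ (r : Vec ℤ n) z → dot (r Vec.++ negV r) z ≡ dot r (left z) - dot r (right z)
  dot-double r z = trans (dot-sum (r Vec.++ negV r) z)
    (trans (sum-++ n _) (cong₂ _+_
      (trans (sum-cong-≗ λ i → cong₂ _*_ (lookup-++ˡ r (negV r) i) (sym (lookup∘tabulate _ i)))
             (sym (dot-sum r (left z))))
      (trans (sum-cong-≗ λ i → cong₂ _*_ (lookup-++ʳ r (negV r) i) (sym (lookup∘tabulate _ i)))
             (trans (sym (dot-sum (negV r) (right z))) (dot-negˡ r (right z))))))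

  dot-double-⊖ : ∀ (r : Vec ℤ n) z → dot (r Vec.++ negV r) z ≡ dot r (left z ⊖ right z)
  dot-double-⊖ r z = trans (dot-double r z) (sym (dot-⊖ r (left z) (right z)))

  double-ker⁻ : ∀ (M : Mat m n) z → InKer (double M) z → InKer M (left z ⊖ right z)
  double-ker⁻ M z k = inKer⁺ λ i → trans (sym (dot-double-⊖ (lookup M i) z))
    (trans (cong (λ r → dot r z) (sym (lookup-map i _ M))) (inKer⁻ {M = double M} k i))

  double-ker⁺ : ∀ (M : Mat m n) z → InKer M (left z ⊖ right z) → InKer (double M) z
  double-ker⁺ M z k = inKer⁺ λ i → trans (cong (λ r → dot r z) (lookup-map i _ M))
    (trans (dot-double-⊖ (lookup M i) z) (inKer⁻ {M = M} k i))

  lookup-left : ∀ (z : Vec ℤ (n ℕ.+ n)) i → lookup (left z) i ≡ lookup z (i Fin.↑ˡ n)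
  lookup-left z i = lookup∘tabulate _ i

  lookup-right : ∀ (z : Vec ℤ (n ℕ.+ n)) i → lookup (right z) i ≡ lookup z (n Fin.↑ʳ i)
  lookup-right z i = lookup∘tabulate _ i

  -- A generator (x , y) of the pairs with M x = M y gives the move x ⊖ y; a decomposition of (w , u) into generators
  -- is a walk from w to u that trades the summands x for the summands y one at a time.
  gen-walk : ∀ {H} → All NonNegV H → ∀ {z : Vec ℤ (n ℕ.+ n)} → Gen H z →
    NonNegV z × Walk (List.map (λ h → left h ⊖ right h) H) (left z) (right z)
  gen-walk H≥0 none = z≥0 , subst (Walk _ (left zeroV)) same done
    where
    z≥0 : NonNegV (zeroV {n ℕ.+ n})
    z≥0 i = subst (0ℤ ≤_) (sym (lookup-zeroV i)) ℤP.≤-refl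
    same : left (zeroV {n ℕ.+ n}) ≡ right (zeroV {n ℕ.+ n})
    same = vec-ext λ i → trans (lookup-left zeroV i) (trans (lookup-zeroV (i Fin.↑ˡ n))
      (sym (trans (lookup-right zeroV i) (lookup-zeroV (n Fin.↑ʳ i)))))
  gen-walk H≥0 {z} (add h h∈H g) with r≥0 , w ← gen-walk H≥0 g =
    subst NonNegV (⊖-⊕-cancel z h) (⊕-nonneg {a = z ⊖ h} {h} r≥0 h≥0) ,
    move trade (inj₁ (∈-map⁺ _ h∈H)) (⊕-nonneg {a = left (z ⊖ h)} {right h} left≥0 right≥0)
      (subst (Walk _ _) end (walk-translate right≥0 w))
    where
    h≥0 : NonNegV h
    h≥0 = All.lookup H≥0 h∈H
    right≥0 : NonNegV (right h)
    right≥0 i = subst (0ℤ ≤_) (sym (lookup-right h i)) (h≥0 _)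
    left≥0 : NonNegV (left (z ⊖ h))
    left≥0 i = subst (0ℤ ≤_) (sym (lookup-left (z ⊖ h) i)) (r≥0 _)
    right-⊖ : right (z ⊖ h) ≡ right z ⊖ right h
    right-⊖ = vec-ext λ i → trans (lookup-right (z ⊖ h) i) (trans (lookup-⊖ z h _)
      (sym (trans (lookup-⊖ (right z) (right h) i) (cong₂ _-_ (lookup-right z i) (lookup-right h i)))))
    end : right (z ⊖ h) ⊕ right h ≡ right z
    end = trans (cong (_⊕ right h) right-⊖) (⊖-⊕-cancel (right z) (right h))
    shuffle : ∀ z x y → z - (z - x + y) ≡ x - y
    shuffle = solve-∀
    trade : left z ⊖ (left (z ⊖ h) ⊕ right h) ≡ left h ⊖ right h
    trade = vec-ext λ i → trans (lookup-⊖ (left z) (left (z ⊖ h) ⊕ right h) i)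
      (trans (cong₂ (λ x y → x - y) (lookup-left z i) (trans (lookup-⊕ (left (z ⊖ h)) (right h) i)
         (cong (_+ lookup (right h) i) (trans (lookup-left (z ⊖ h) i) (lookup-⊖ z h (i Fin.↑ˡ n))))))
      (trans (shuffle (lookup z (i Fin.↑ˡ n)) (lookup h (i Fin.↑ˡ n)) (lookup (right h) i))
      (sym (trans (lookup-⊖ (left h) (right h) i) (cong (_- lookup (right h) i) (lookup-left h i))))))

markovBasis : ∀ (M : Mat m n) → ∃ (IsMarkovBasis M)
markovBasis {n = n} M with H , sound , complete ← hilbertBasis (Double.double n M) =
  List.map (λ h → Double.left n h ⊖ Double.right n h) H , All.tabulate ker , walk
  where
  open Double n
  ker : ∀ {v} → v LM.∈ List.map (λ h → left h ⊖ right h) H → InKer M v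
  ker v∈ with h , h∈H , refl ← ∈-map⁻ _ v∈ = double-ker⁻ M h (proj₂ (All.lookup sound h∈H))
  walk : ∀ (w u : Vec ℕ n) → InKer M (toℤV w ⊖ toℤV u) → Walk _ (toℤV w) (toℤV u)
  walk w u k = subst₂ (Walk _) left-z right-z
    (proj₂ (gen-walk (All.map proj₁ sound) (complete z z≥0
      (double-ker⁺ M z (subst (InKer M) (sym (cong₂ _⊖_ left-z right-z)) k)))))
    where
    z : Vec ℤ (n ℕ.+ n)
    z = toℤV w Vec.++ toℤV u
    z≥0 : NonNegV z
    z≥0 = subst NonNegV (map-++ +_ w u) (toℤV-nonneg (w Vec.++ u))
    left-z : left z ≡ toℤV w
    left-z = vec-ext λ i → trans (lookup-left z i) (lookup-++ˡ (toℤV w) (toℤV u) i)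
    right-z : right z ≡ toℤV u
    right-z = vec-ext λ i → trans (lookup-right z i) (lookup-++ʳ (toℤV w) (toℤV u) i)

-- Kernels of Lawrence liftings

module Blocks (n : ℕ) where

  row : ∀ r → Vec ℤ (r ℕ.* n) → Fin r → Vec ℤ n
  row r u k = tabulate (λ i → lookup u (Fin.combine k i))

  lookup-row : ∀ r u k i → lookup (row r u k) i ≡ lookup u (Fin.combine k i)
  lookup-row r u k i = lookup∘tabulate _ i

  assemble : ∀ r → (Fin r → Fin n → ℤ) → Vec ℤ (r ℕ.* n)
  assemble r f = Vec.concat (tabulate λ k → tabulate (f k))

  lookup-assemble : ∀ r f k i → lookup (assemble r f) (Fin.combine k i) ≡ f k i
  lookup-assemble r f k i = trans (lookup-concat (tabulate λ k → tabulate (f k)) k i)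
    (trans (cong (λ v → lookup v i) (lookup∘tabulate (λ k → tabulate (f k)) k)) (lookup∘tabulate (f k) i))

  combine-elim : ∀ r (P : Fin (r ℕ.* n) → Set) → (∀ k i → P (Fin.combine k i)) → ∀ t → P t
  combine-elim r P h t with k , i , refl ← combine-surjective {r} {n} t = h k i

  sum-combine : ∀ r (f : Fin (r ℕ.* n) → ℤ) → sum f ≡ sum (λ k → sum (λ i → f (Fin.combine {r} {n} k i)))
  sum-combine zero    f = refl
  sum-combine (suc r) f = trans (sum-++ n f)
    (cong (_+_ (sum (λ i → f (i Fin.↑ˡ (r ℕ.* n))))) (sum-combine r (λ j → f (n Fin.↑ʳ j))))

  lookup-blocks : ∀ r (u : Vec ℤ (r ℕ.* n)) k → lookup (blocks r u) k ≡ row r u k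
  lookup-blocks (suc r) u k with Vec.splitAt n u
  lookup-blocks (suc r) u Fin.zero    | ys , zs , refl = vec-ext λ i →
    sym (trans (lookup-row (suc r) (ys Vec.++ zs) Fin.zero i) (lookup-++ˡ ys zs i))
  lookup-blocks (suc r) u (Fin.suc k) | ys , zs , refl = trans (lookup-blocks r zs k) (vec-ext λ i →
    trans (lookup-row r zs k i) (sym (trans (lookup-row (suc r) (ys Vec.++ zs) (Fin.suc k) i)
      (lookup-++ʳ ys zs (Fin.combine k i)))))

  -- Together with `sumRow` these are the rows of `lawrence r A`, so its kernel splits into
  -- conditions on single blocks and on columns.
  blockRow : ∀ r → Fin r → Vec ℤ n → Vec ℤ (r ℕ.* n)
  blockRow r k a = Vec.concat (tabulate {n = r} λ k′ → if does (k Fin.≟ k′) then a else zeroV)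

  sumRow : ∀ r → Fin n → Vec ℤ (r ℕ.* n)
  sumRow r j = Vec.concat (Vec.replicate r (unitV j))

  dot-concat : ∀ r (rows : Vec (Vec ℤ n) r) u → dot (Vec.concat rows) u ≡ sum (λ k → dot (lookup rows k) (row r u k))
  dot-concat r rows u = trans (dot-sum (Vec.concat rows) u) (trans (sum-combine r _)
    (sum-cong-≗ λ k → trans
      (sum-cong-≗ λ i → cong₂ _*_ (lookup-concat rows k i) (sym (lookup-row r u k i)))
      (sym (dot-sum (lookup rows k) (row r u k)))))

  dot-blockRow : ∀ r k a u → dot (blockRow r k a) u ≡ dot a (row r u k)
  dot-blockRow r k a u = trans (dot-concat r (tabulate λ k′ → if does (k Fin.≟ k′) then a else zeroV) u) (trans (sum-single _ k off) on)
    where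
    pick : ∀ k′ → lookup (tabulate λ k′ → if does (k Fin.≟ k′) then a else zeroV) k′ ≡
      (if does (k Fin.≟ k′) then a else zeroV)
    pick = lookup∘tabulate _
    off : ∀ k′ → k ≢ k′ → dot (lookup (tabulate λ k′ → if does (k Fin.≟ k′) then a else zeroV) k′) (row r u k′) ≡ 0ℤ
    off k′ k≢k′ rewrite pick k′ with k Fin.≟ k′
    ... | yes k≡k′ = ⊥-elim (k≢k′ k≡k′)
    ... | no _     = dot-zeroˡ (row r u k′)
    on : dot (lookup (tabulate λ k′ → if does (k Fin.≟ k′) then a else zeroV) k) (row r u k) ≡ dot a (row r u k)
    on rewrite pick k with k Fin.≟ k
    ... | yes _  = refl
    ... | no k≢k = ⊥-elim (k≢k refl)

  dot-sumRow : ∀ r j u → dot (sumRow r j) u ≡ sum (λ k → lookup u (Fin.combine {r} k j))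
  dot-sumRow r j u = trans (dot-concat r (Vec.replicate r (unitV j)) u) (sum-cong-≗ λ k →
    trans (cong (λ v → dot v (row r u k)) (lookup-replicate k (unitV j)))
    (trans (dot-sum (unitV j) (row r u k))
    (trans (sum-single _ j λ i j≢i → cong (_* lookup (row r u k) i) (unitV-other j≢i))
    (trans (cong (_* lookup (row r u k) j) (unitV-self j))
    (trans (ℤP.*-identityˡ (lookup (row r u k) j)) (lookup-row r u k j))))))

  ColumnSums : ∀ r → Vec ℤ (r ℕ.* n) → Set
  ColumnSums r u = ∀ j → sum (λ k → lookup u (Fin.combine {r} k j)) ≡ 0ℤ

  lawrence-ker⁺ : ∀ r (A : Mat m n) u → (∀ k → InKer A (row r u k)) → ColumnSums r u → InKer (lawrence r A) u
  lawrence-ker⁺ r A u rows cols = inKer⁺ {M = lawrence r A} (VAllP.lookup⁺ {P = λ v → dot v u ≡ 0ℤ} (VAllP.++⁺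
    (VAllP.concat⁺ (VAllP.tabulate⁺ {n = r} λ k → VAllP.map⁺ (VAllP.lookup⁻ λ s →
      trans (dot-blockRow r k (lookup A s) u) (inKer⁻ {M = A} (rows k) s))))
    (VAllP.tabulate⁺ λ j → trans (dot-sumRow r j u) (cols j))))

  lawrence-ker⁻ : ∀ r (A : Mat m n) u → InKer (lawrence r A) u → (∀ k → InKer A (row r u k)) × ColumnSums r u
  lawrence-ker⁻ r A u k with VAllP.++⁻ (Vec.concat (tabulate {n = r} λ k → map (blockRow r k) A))
    (VAllP.lookup⁻ {P = λ v → dot v u ≡ 0ℤ} (inKer⁻ {M = lawrence r A} k))
  ... | top , bottom =
    (λ k → inKer⁺ {M = A} λ s → trans (sym (dot-blockRow r k (lookup A s) u))
      (VAllP.lookup⁺ (VAllP.map⁻ (VAllP.tabulate⁻ (VAllP.concat⁻ _ top) k)) s)) ,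
    λ j → trans (sym (dot-sumRow r j u)) (VAllP.tabulate⁻ bottom j)

  -- The total is the sum of the column sums, each of which the identity blocks force to be zero.
  lawrence-homogeneous : ∀ r (A : Mat m n) → Homogeneous (lawrence r A)
  lawrence-homogeneous r A u k = trans (sum-combine r (lookup u))
    (trans (∑-comm (λ k i → lookup u (Fin.combine {r} k i))) (sum-zero (proj₂ (lawrence-ker⁻ r A u k))))

count-mono : ∀ {A B : Set} {P : A → Set} {Q : B → Set} (P? : ∀ x → Dec (P x)) (Q? : ∀ x → Dec (Q x))
  (xs : Vec A n) (ys : Vec B n) → (∀ k → P (lookup xs k) → Q (lookup ys k)) → Vec.count P? xs ℕ.≤ Vec.count Q? ys
count-mono P? Q? []       []       h = ℕ.z≤n
count-mono P? Q? (x ∷ xs) (y ∷ ys) h with P? x | Q? y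
... | yes p | yes q = ℕ.s≤s (count-mono P? Q? xs ys (h ∘ Fin.suc))
... | yes p | no ¬q = ⊥-elim (¬q (h Fin.zero p))
... | no _  | yes q = ℕP.m≤n⇒m≤1+n (count-mono P? Q? xs ys (h ∘ Fin.suc))
... | no _  | no ¬q = count-mono P? Q? xs ys (h ∘ Fin.suc)

-- Bouquets

*-≡0 : ∀ {a x} → a ≢ 0ℤ → a * x ≡ 0ℤ → x ≡ 0ℤ
*-≡0 {a} a≢0 eq with ℤP.i*j≡0⇒i≡0∨j≡0 a eq
... | inj₁ a≡0 = ⊥-elim (a≢0 a≡0)
... | inj₂ x≡0 = x≡0

*-cancel : ∀ {a x y} → a ≢ 0ℤ → a * x ≡ a * y → x ≡ y
*-cancel {a} {x} {y} a≢0 eq =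
  ℤP.*-cancelˡ-≡ a x y {{ℤ.≢-nonZero a≢0}} eq

bezout : ∀ m n → ∃[ x ] ∃[ y ] (x * + m + y * + n ≡ + gcd m n)
bezout m n with Bézout.identity (gcd-GCD m n)
... | Bézout.Identity.+- x y eq = + x , - (+ y) ,
  trans (cong (_+ - (+ y) * + n) (lift x m y n eq)) (cancel (+ gcd m n) (+ y) (+ n))
  where
  lift : ∀ x m y n → gcd m n ℕ.+ y ℕ.* n ≡ x ℕ.* m → + x * + m ≡ + gcd m n + + y * + n
  lift x m y n eq = trans (sym (ℤP.pos-* x m)) (trans (cong +_ (sym eq))
    (trans (ℤP.pos-+ (gcd m n) (y ℕ.* n)) (cong (_+_ (+ gcd m n)) (ℤP.pos-* y n))))
  cancel : ∀ d y n → d + y * n + - y * n ≡ d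
  cancel = solve-∀
... | Bézout.Identity.-+ x y eq = - (+ x) , + y ,
  trans (cong (_+_ (- (+ x) * + m)) (lift x m y n eq)) (cancel (+ gcd m n) (+ x) (+ m))
  where
  lift : ∀ x m y n → gcd m n ℕ.+ x ℕ.* m ≡ y ℕ.* n → + y * + n ≡ + gcd m n + + x * + m
  lift x m y n eq = trans (sym (ℤP.pos-* y n)) (trans (cong +_ (sym eq))
    (trans (ℤP.pos-+ (gcd m n) (x ℕ.* m)) (cong (_+_ (+ gcd m n)) (ℤP.pos-* x m))))
  cancel : ∀ d x m → - x * m + (d + x * m) ≡ d
  cancel = solve-∀

unit : ℤ → ℤ
unit x = ℤ.sign x ℤ.◃ 1

unit-unit : ∀ x → unit x * unit x ≡ 1ℤ
unit-unit x with ℤ.sign x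
... | Sign.+ = refl
... | Sign.- = refl

unit-abs : ∀ x → unit x * x ≡ + ∣ x ∣
unit-abs (+ n)    = ℤP.*-identityˡ (+ n)
unit-abs -[1+ n ] = ℤP.-1*i≡-i -[1+ n ]

-- The gcd as an integer combination supported on `B`; it is what makes the multiplier in `encodes`
-- an integer.
gcdOn-bezout : ∀ (B : Subset n) (f : Fin n → ℤ) →
  Σ[ s ∈ (Fin _ → ℤ) ] ((∀ k → k ∉ B → s k ≡ 0ℤ) × sum (λ k → s k * f k) ≡ + gcdOn B f)
gcdOn-bezout [] f = (λ ()) , (λ ()) , refl
gcdOn-bezout (false ∷ B) f with s , off , eq ← gcdOn-bezout B (f ∘ Fin.suc) =
  (λ { Fin.zero → 0ℤ ; (Fin.suc k) → s k }) ,
  (λ { Fin.zero _ → refl ; (Fin.suc k) k∉ → off k (k∉ ∘ there) }) ,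
  trans (ℤP.+-identityˡ _) eq
gcdOn-bezout (true ∷ B) f
  with s , off , eq ← gcdOn-bezout B (f ∘ Fin.suc)
  with x , y , eq′ ← bezout ∣ f Fin.zero ∣ (gcdOn B (f ∘ Fin.suc)) =
  (λ { Fin.zero → x * unit (f Fin.zero) ; (Fin.suc k) → y * s k }) ,
  (λ { Fin.zero 0∉ → ⊥-elim (0∉ here) ; (Fin.suc k) k∉ → trans (cong (y *_) (off k (k∉ ∘ there))) (ℤP.*-zeroʳ y) }) ,
  trans (cong₂ _+_
    (trans (ℤP.*-assoc x (unit (f Fin.zero)) (f Fin.zero)) (cong (x *_) (unit-abs (f Fin.zero))))
    (trans (sum-cong-≗ λ k → ℤP.*-assoc y (s k) (f (Fin.suc k)))
      (trans (sym (*-distribˡ-sum y (λ k → s k * f (Fin.suc k)))) (cong (y *_) eq)))) eq′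

lookup-transpose : ∀ {A : Set} (M : Vec (Vec A n) m) t s → lookup (lookup (Vec.transpose M) t) s ≡ lookup (lookup M s) t
lookup-transpose {n = n} (as ∷ M) t s = trans (cong (λ v → lookup v s) first) (rest s)
  where
  first : lookup (Vec.transpose (as ∷ M)) t ≡ lookup as t ∷ lookup (Vec.transpose M) t
  first = trans (lookup-⊛ t (Vec.replicate n Vec._∷_ Vec.⊛ as) (Vec.transpose M))
    (cong (λ f → f (lookup (Vec.transpose M) t))
      (trans (lookup-⊛ t (Vec.replicate n Vec._∷_) as) (cong (λ f → f (lookup as t)) (lookup-replicate t Vec._∷_))))
  rest : ∀ s → lookup (lookup as t ∷ lookup (Vec.transpose M) t) s ≡ lookup (lookup (as ∷ M) s) t
  rest Fin.zero    = refl
  rest (Fin.suc s) = lookup-transpose M t s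

lookup-·ᵥ : ∀ (A : Mat m n) v s → lookup (A ·ᵥ v) s ≡ sum (λ t → lookup (lookup A s) t * lookup v t)
lookup-·ᵥ A v s = trans (lookup-map s _ A) (dot-sum (lookup A s) v)

lookup-ᵥ· : ∀ (v : Vec ℤ m) (A : Mat m n) t → lookup (v ᵥ· A) t ≡ sum (λ s → lookup v s * lookup (lookup A s) t)
lookup-ᵥ· v A t = trans (lookup-map t (dot v) (Vec.transpose A)) (trans (dot-sum v (lookup (Vec.transpose A) t))
  (sum-cong-≗ λ s → cong (lookup v s *_) (lookup-transpose A t s)))

row-combination-ker : ∀ (v : Vec ℤ m) (A : Mat m n) {y} → InKer A y → sum (λ t → lookup (v ᵥ· A) t * lookup y t) ≡ 0ℤ
row-combination-ker v A {y} k =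
  trans (sum-cong-≗ λ t → trans (cong (_* lookup y t) (lookup-ᵥ· v A t))
          (*-distribʳ-sum (lookup y t) (λ s → lookup v s * lookup (lookup A s) t)))
  (trans (∑-comm (λ t s → lookup v s * lookup (lookup A s) t * lookup y t))
  (sum-zero λ s →
    trans (sum-cong-≗ λ t → ℤP.*-assoc (lookup v s) (lookup (lookup A s) t) (lookup y t))
    (trans (sym (*-distribˡ-sum (lookup v s) (λ t → lookup (lookup A s) t * lookup y t)))
    (trans (cong (lookup v s *_) (trans (sym (dot-sum (lookup A s) y)) (inKer⁻ {M = A} k s)))
           (ℤP.*-zeroʳ (lookup v s))))))

sum-pair : ∀ (f : Fin n → ℤ) {i k} → i ≢ k → (∀ t → i ≢ t → k ≢ t → f t ≡ 0ℤ) → sum f ≡ f i + f k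
sum-pair {n} f {i} {k} i≢k off = trans (regroup (sum f) (f k)) (cong (_+ f k) rest)
  where
  regroup : ∀ s x → s ≡ s - x + x
  regroup = solve-∀
  g : Fin n → ℤ
  g t = f k * lookup (unitV k) t
  sum-g : sum g ≡ f k
  sum-g = trans (sym (*-distribˡ-sum (f k) (lookup (unitV k))))
    (trans (cong (f k *_) (unitV-total k)) (ℤP.*-identityʳ (f k)))
  g-off : ∀ {t} → k ≢ t → g t ≡ 0ℤ
  g-off k≢t = trans (cong (f k *_) (unitV-other k≢t)) (ℤP.*-zeroʳ (f k))
  f-g : ∀ t → i ≢ t → f t - g t ≡ 0ℤ
  f-g t i≢t with k Fin.≟ t
  ... | yes refl = trans
    (cong (λ z → f k - z) (trans (cong (f k *_) (unitV-self k)) (ℤP.*-identityʳ (f k))))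
    (ℤP.+-inverseʳ (f k))
  ... | no k≢t   = cong₂ _-_ (off t i≢t k≢t) (g-off k≢t)
  rest : sum f - f k ≡ f i
  rest = trans (cong (λ z → sum f - z) (sym sum-g)) (trans (sym (sum-sub f g))
    (trans (sum-single (λ t → f t - g t) i f-g) (trans (cong (λ z → f i - z) (g-off (i≢k ∘ sym))) (ℤP.+-identityʳ (f i)))))

module _ (A : Mat m n) where

  -- Dependence of two Gale transforms with both scalars nonzero, stated on kernel vectors so that
  -- no basis of the kernel enters.
  Proportional : Fin n → Fin n → Set
  Proportional i k = ∃[ α ] ∃[ β ] (α ≢ 0ℤ × β ≢ 0ℤ × (∀ y → InKer A y → α * lookup y i ≡ β * lookup y k))

  proportional-sym : ∀ {i k} → Proportional i k → Proportional k i
  proportional-sym (α , β , α≢0 , β≢0 , p) = β , α , β≢0 , α≢0 , λ y ky → sym (p y ky)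

  proportional-trans : ∀ {i k l} → Proportional i k → Proportional k l → Proportional i l
  proportional-trans {i} {k} {l} (α , β , α≢0 , β≢0 , p) (γ , δ , γ≢0 , δ≢0 , p′) =
    γ * α , β * δ , (λ eq → α≢0 (*-≡0 γ≢0 eq)) , (λ eq → δ≢0 (*-≡0 β≢0 eq)) ,
    λ y ky → trans (ℤP.*-assoc γ α (lookup y i)) (trans (cong (γ *_) (p y ky))
      (trans (swap γ β (lookup y k)) (trans (cong (β *_) (p′ y ky)) (sym (ℤP.*-assoc β δ (lookup y l))))))
    where
    swap : ∀ γ β y → γ * (β * y) ≡ β * (γ * y)
    swap = solve-∀

  -- A row combination supported on {i, k} vanishes on every kernel vector, which leaves a relation
  -- with two nonzero coefficients.
  adjacent⇒proportional : ∀ {i k} → Adjacent A i k → Proportional i k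
  adjacent⇒proportional {i} {k} (i≢k , v , supp) =
    form i , - form k , proj₂ (supp i) (inj₁ refl) ,
    (λ eq → proj₂ (supp k) (inj₂ refl) (trans (sym (ℤP.neg-involutive (form k))) (cong (-_) eq))) ,
    λ y ky → trans (isolate (form i * lookup y i) (form k) (lookup y k))
      (trans (cong (_+ - form k * lookup y k)
        (trans (sym (sum-pair (λ t → form t * lookup y t) i≢k (λ t i≢t k≢t → cong (_* lookup y t) (off t i≢t k≢t))))
               (row-combination-ker v A ky)))
      (ℤP.+-identityˡ (- form k * lookup y k)))
    where
    form : Fin n → ℤ
    form = lookup (v ᵥ· A)
    isolate : ∀ x β y → x ≡ x + β * y + - β * y
    isolate = solve-∀
    off : ∀ t → i ≢ t → k ≢ t → form t ≡ 0ℤ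
    off t i≢t k≢t with form t ℤ.≟ 0ℤ
    ... | yes eq = eq
    ... | no neq with proj₁ (supp t) neq
    ... | inj₁ t≡i = ⊥-elim (i≢t (sym t≡i))
    ... | inj₂ t≡k = ⊥-elim (k≢t (sym t≡k))

  connected⇒proportional : ∀ {i k} → EqClosure (Adjacent A) i k → Proportional i k
  connected⇒proportional ε             = 1ℤ , 1ℤ , (λ ()) , (λ ()) , λ _ _ → refl
  connected⇒proportional (fwd a ◅ path) = proportional-trans (adjacent⇒proportional a) (connected⇒proportional path)
  connected⇒proportional (bwd a ◅ path) =
    proportional-trans (proportional-sym (adjacent⇒proportional a)) (connected⇒proportional path)

  -- Two kernel vectors have the same ratio of entries at `i` and `k`; cross-multiplying eliminates
  -- the unknown `α` and `β`.
  proportional⇒cross : ∀ {i k} → Proportional i k → ∀ {y h} → InKer A y → InKer A h →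
    lookup y k * lookup h i ≡ lookup y i * lookup h k
  proportional⇒cross {i} {k} (α , β , α≢0 , _ , p) {y} {h} ky kh = *-cancel α≢0
    (trans (shuffle α (lookup y k) (lookup h i)) (trans (cong (lookup y k *_) (p h kh))
    (trans (shuffle′ (lookup y k) β (lookup h k)) (trans (cong (lookup h k *_) (sym (p y ky)))
      (shuffle″ (lookup h k) α (lookup y i))))))
    where
    shuffle : ∀ α y h → α * (y * h) ≡ y * (α * h)
    shuffle = solve-∀
    shuffle′ : ∀ y β h → y * (β * h) ≡ h * (β * y)
    shuffle′ = solve-∀
    shuffle″ : ∀ h α y → h * (α * y) ≡ α * (y * h)
    shuffle″ = solve-∀

  -- The common consequences of the free and the non-free case. `positive` records the sign
  -- normalisation, and `multiple` says that on the bouquet the kernel consists of integer multiples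
  -- of `c`.
  record Encodes (B : Subset n) (c : Vec ℤ n) : Set where
    field
      supported  : ∀ {i} → i ∉ B → lookup c i ≡ 0ℤ
      nonzero    : ∀ {i} → i ∈ B → lookup c i ≢ 0ℤ
      positive   : ∃[ i ] (i ∈ B × 0ℤ < lookup c i)
      multiple   : ∀ y → InKer A y → ∃[ z ] (∀ i → i ∈ B → lookup y i ≡ z * lookup c i)

  module _ (G : Mat n d) (gale : IsGaleMatrix A G) {B : Subset n}
           (connected : ∀ {i k} → i ∈ B → k ∈ B → EqClosure (Adjacent A) i k) where

    0<-from-* : ∀ {g x} → 0ℤ < + g * x → 0ℤ < x
    0<-from-* {g} {x} h = ℤP.*-cancelˡ-<-nonNeg (+ g) (subst (_< + g * x) (sym (ℤP.*-zeroʳ (+ g))) h)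

    encodes : ∀ {c} → IsBouquetVector G B c → Encodes B c
    encodes {c} (inj₁ (free , _ , supp , i₀ , 0<c , _)) = record
      { supported = λ {i} → off i
      ; nonzero   = λ {i} → proj₂ (supp i)
      ; positive  = i₀ , proj₁ (supp i₀) (λ eq → ℤP.<-irrefl (sym eq) 0<c) , 0<c
      ; multiple  = λ y ky → 0ℤ , zero-on y ky
      }
      where
      off : ∀ i → i ∉ B → lookup c i ≡ 0ℤ
      off i i∉B with lookup c i ℤ.≟ 0ℤ
      ... | yes eq = eq
      ... | no neq = ⊥-elim (i∉B (proj₁ (supp i) neq))
      zero-on : ∀ y → InKer A y → ∀ i → i ∈ B → lookup y i ≡ 0ℤ
      zero-on y ky i i∈B with λ′ , refl ← proj₁ (proj₂ gale) y ky =
        trans (lookup-map i _ G) (trans (cong (λ r → dot r λ′) (free i i∈B)) (dot-zeroˡ λ′))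
    encodes {c} (inj₂ (_ , j , h≢0 , i₀ , i₀∈B , _ , spec)) = record
      { supported = λ {i} → proj₂ (spec i)
      ; nonzero   = λ {i} i∈B ci≡0 → gc≢0 i∈B (trans (cong (+ g *_) ci≡0) (ℤP.*-zeroʳ (+ g)))
      ; positive  = i₀ , i₀∈B , 0<-from-* {g} (subst (0ℤ <_) (sym (trans (proj₁ (spec i₀) i₀∈B) (unit-abs (h i₀))))
                      (0<abs (h≢0 i₀ i₀∈B)))
      ; multiple  = λ y ky → scale y , λ i i∈B → sym (*-cancel g≢0 (proportion y ky i i∈B))
      }
      where
      h : Fin n → ℤ
      h i = lookup (lookup G i) j
      g : ℕ
      g = gcdOn B h
      e : ℤ
      e = unit (h i₀)
      0<abs : ∀ {x} → x ≢ 0ℤ → 0ℤ < + ∣ x ∣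
      0<abs {+ zero}   x≢0 = ⊥-elim (x≢0 refl)
      0<abs {+ suc n}  _   = +<+ (ℕ.s≤s ℕ.z≤n)
      0<abs { -[1+ n ]} _  = +<+ (ℕ.s≤s ℕ.z≤n)
      e≢0 : e ≢ 0ℤ
      e≢0 eq with () ← trans (sym (unit-unit (h i₀))) (cong (λ x → x * x) eq)
      gc≢0 : ∀ {i} → i ∈ B → + g * lookup c i ≢ 0ℤ
      gc≢0 {i} i∈B eq = h≢0 i i∈B (*-≡0 e≢0 (trans (sym (proj₁ (spec i) i∈B)) eq))
      g≢0 : + g ≢ 0ℤ
      g≢0 eq = gc≢0 i₀∈B (cong (_* lookup c i₀) eq)
      s : Fin n → ℤ
      s = proj₁ (gcdOn-bezout B h)
      s-off : ∀ k → k ∉ B → s k ≡ 0ℤ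
      s-off = proj₁ (proj₂ (gcdOn-bezout B h))
      s-sum : sum (λ k → s k * h k) ≡ + g
      s-sum = proj₂ (proj₂ (gcdOn-bezout B h))
      -- Weighting y_k h_i = y_i h_k by `s k` and summing gives (Σ s_k y_k) h_i = g y_i. With g c_i
      -- = e h_i and e² = 1 this becomes y_i = (e Σ s_k y_k) c_i.
      scale : Vec ℤ n → ℤ
      scale y = e * sum (λ k → s k * lookup y k)
      h-ker : InKer A (column j G)
      h-ker = proj₁ gale j
      lookup-h : ∀ i → lookup (column j G) i ≡ h i
      lookup-h i = lookup-map i _ G
      crossed : ∀ y → InKer A y → ∀ i k → i ∈ B → k ∈ B → lookup y k * h i ≡ lookup y i * h k
      crossed y ky i k i∈B k∈B = subst₂ (λ a b → lookup y k * a ≡ lookup y i * b) (lookup-h i) (lookup-h k)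
        (proportional⇒cross (connected⇒proportional (connected i∈B k∈B)) {y} {column j G} ky h-ker)
      terms : ∀ y → InKer A y → ∀ i → i ∈ B → ∀ k → s k * lookup y k * h i ≡ lookup y i * (s k * h k)
      terms y ky i i∈B k with k ∈? B
      ... | yes k∈B = trans (ℤP.*-assoc (s k) (lookup y k) (h i))
        (trans (cong (s k *_) (crossed y ky i k i∈B k∈B)) (swap (s k) (lookup y i) (h k)))
        where
        swap : ∀ s y h → s * (y * h) ≡ y * (s * h)
        swap = solve-∀
      ... | no k∉B = trans (cong (λ x → x * lookup y k * h i) (s-off k k∉B))
        (sym (trans (cong (λ x → lookup y i * (x * h k)) (s-off k k∉B)) (ℤP.*-zeroʳ (lookup y i))))
      proportion : ∀ y → InKer A y → ∀ i → i ∈ B → + g * (scale y * lookup c i) ≡ + g * lookup y i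
      proportion y ky i i∈B =
        trans (shuffle (+ g) e (sum (λ k → s k * lookup y k)) (lookup c i))
        (trans (cong (λ x → e * sum (λ k → s k * lookup y k) * x) (proj₁ (spec i) i∈B))
        (trans (shuffle′ e (sum (λ k → s k * lookup y k)) (h i))
        (trans (cong (_* (sum (λ k → s k * lookup y k) * h i)) (unit-unit (h i₀)))
        (trans (ℤP.*-identityˡ _)
        (trans (*-distribʳ-sum (h i) (λ k → s k * lookup y k))
        (trans (sum-cong-≗ (terms y ky i i∈B))
        (trans (sym (*-distribˡ-sum (lookup y i) (λ k → s k * h k)))
        (trans (cong (lookup y i *_) s-sum) (ℤP.*-comm (lookup y i) (+ g))))))))))
        where
        shuffle : ∀ g e S c → g * (e * S * c) ≡ e * S * (g * c)
        shuffle = solve-∀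
        shuffle′ : ∀ e S h → e * S * (e * h) ≡ e * e * (S * h)
        shuffle′ = solve-∀

-- Decidability of finitely many propositions is irrefutable, hence available while deriving a
-- contradiction. Adjacency quantifies over all integer row combinations, so it is not decided
-- directly.
¬¬-decidable : ∀ {n} (P : Fin n → Set) → ¬ ¬ (∀ k → Dec (P k))
¬¬-decidable {zero}  P ¬d = ¬d λ ()
¬¬-decidable {suc n} P ¬d = ¬¬-decidable (P ∘ Fin.suc) λ d →
  ¬d (λ { Fin.zero → no (λ p → ¬d (λ { Fin.zero → yes p ; (Fin.suc k) → d k })) ; (Fin.suc k) → d k })

module _ {P : Fin n → Set} (P? : ∀ k → Dec (P k)) where

  subset : Subset n
  subset = tabulate (λ k → does (P? k))

  subset⁻ : ∀ {k} → k ∈ subset → P k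
  subset⁻ {k} k∈ = holds (P? k) (trans (sym (lookup∘tabulate (does ∘ P?) k)) ([]=⇒lookup k∈))
    where
    holds : (d : Dec (P k)) → does d ≡ true → P k
    holds (yes p) _ = p

  subset⁺ : ∀ {k} → P k → k ∈ subset
  subset⁺ {k} p = lookup⇒[]= k subset (trans (lookup∘tabulate (does ∘ P?) k) holds)
    where
    holds : does (P? k) ≡ true
    holds = dec-true (P? k) p

-- What the transfer needs: `D` intertwines `AB` with `A` and reaches all of the kernel of `A`. The
-- positive coefficient at `rep l` makes `D` injective and lets it reflect nonnegativity.
record Bouquets (A : Mat m n) (AB : Mat m q) : Set where
  field
    bouquet     : Fin n → Fin q
    coeff       : Fin n → ℤ
    coeff≢0     : ∀ i → coeff i ≢ 0ℤ
    rep         : Fin q → Fin n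
    bouquet-rep : ∀ l → bouquet (rep l) ≡ l
    coeff-rep   : ∀ l → 0ℤ < coeff (rep l)

  D : Vec ℤ q → Vec ℤ n
  D z = tabulate (λ i → lookup z (bouquet i) * coeff i)

  field
    D-product    : ∀ z → A ·ᵥ D z ≡ AB ·ᵥ z
    D-surjective : ∀ y → InKer A y → ∃[ z ] (∀ i → lookup y i ≡ lookup z (bouquet i) * coeff i)

bouquets : ∀ {A : Mat m n} {AB : Mat m q} → IsBouquetMatrix A AB → Bouquets A AB
bouquets {m} {n} {q} {A} {AB} (d , G , gale , Bs , isB , allB , injB , cs , vec) = record
  { bouquet      = ℓ
  ; coeff        = coeff
  ; coeff≢0      = λ i → E.nonzero (ℓ i) (i∈ℓ i)
  ; rep          = rep
  ; bouquet-rep  = ℓ-rep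
  ; coeff-rep    = λ l → subst (λ l′ → 0ℤ < lookup (lookup cs l′) (rep l)) (sym (ℓ-rep l)) (proj₂ (proj₂ (E.positive l)))
  ; D-product    = D-product
  ; D-surjective = D-surjective
  }
  where
  infix 4 _~_
  _~_ : Fin n → Fin n → Set
  _~_ = EqClosure (Adjacent A)
  connected : ∀ l {i k} → i ∈ lookup Bs l → k ∈ lookup Bs l → i ~ k
  connected l i∈ k∈ with i₀ , char ← isB l =
    transitive (Adjacent A) (symmetric (Adjacent A) (proj₁ (char _) i∈)) (proj₁ (char _) k∈)
  absorb : ∀ l {i k} → i ∈ lookup Bs l → i ~ k → k ∈ lookup Bs l
  absorb l i∈ i~k with i₀ , char ← isB l = proj₂ (char _) (transitive (Adjacent A) (proj₁ (char _) i∈) i~k)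
  enc : ∀ l → Encodes A (lookup Bs l) (lookup cs l)
  enc l = encodes A G gale (connected l) (proj₁ (vec l))
  module E (l : Fin q) = Encodes (enc l)
  covered : ∀ i → ∃[ l ] i ∈ lookup Bs l
  covered i with any? (λ l → i ∈? lookup Bs l)
  ... | yes found = found
  -- Membership in some listed bouquet is decidable, so connectedness may be assumed decidable here.
  ... | no uncovered = ⊥-elim (¬¬-decidable (i ~_) λ d →
    let l , eq = allB (subset d) (i , λ k → subset⁻ d , subset⁺ d)
    in uncovered (l , subst (i ∈_) (sym eq) (subset⁺ d ε)))
  ℓ : Fin n → Fin q
  ℓ i = proj₁ (covered i)
  i∈ℓ : ∀ i → i ∈ lookup Bs (ℓ i)
  i∈ℓ i = proj₂ (covered i)
  unique : ∀ {i l l′} → i ∈ lookup Bs l → i ∈ lookup Bs l′ → l ≡ l′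
  unique {i} {l} {l′} i∈ i∈′ = injB l l′ (⊆-antisym
    (λ k∈ → absorb l′ i∈′ (connected l i∈ k∈)) (λ k∈ → absorb l i∈ (connected l′ i∈′ k∈)))
  coeff : Fin n → ℤ
  coeff i = lookup (lookup cs (ℓ i)) i
  rep : Fin q → Fin n
  rep l = proj₁ (E.positive l)
  ℓ-rep : ∀ l → ℓ (rep l) ≡ l
  ℓ-rep l = unique (i∈ℓ (rep l)) (proj₁ (proj₂ (E.positive l)))
  D : Vec ℤ q → Vec ℤ n
  D z = tabulate (λ i → lookup z (ℓ i) * coeff i)
  column-sum : ∀ l s → lookup (lookup AB s) l ≡ sum (λ i → lookup (lookup A s) i * lookup (lookup cs l) i)
  column-sum l s = trans (sym (lookup-map s _ AB)) (trans (cong (λ v → lookup v s) (proj₂ (vec l)))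
    (lookup-·ᵥ A (lookup cs l) s))
  D-product : ∀ z → A ·ᵥ D z ≡ AB ·ᵥ z
  D-product z = vec-ext λ s → sym (trans (lookup-·ᵥ AB z s)
    (trans (sum-cong-≗ λ l → trans (cong (_* lookup z l) (column-sum l s))
              (*-distribʳ-sum (lookup z l) (λ i → lookup (lookup A s) i * lookup (lookup cs l) i)))
    (trans (∑-comm (λ l i → lookup (lookup A s) i * lookup (lookup cs l) i * lookup z l))
    (trans (sum-cong-≗ λ i → trans
              (sum-single (λ l → lookup (lookup A s) i * lookup (lookup cs l) i * lookup z l) (ℓ i) (off s i))
              (shuffle (lookup (lookup A s) i) (coeff i) (lookup z (ℓ i))))
    (trans (sum-cong-≗ λ i → cong (lookup (lookup A s) i *_) (sym (lookup∘tabulate (λ i → lookup z (ℓ i) * coeff i) i)))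
    (sym (lookup-·ᵥ A (D z) s)))))))
    where
    shuffle : ∀ a c z → a * c * z ≡ a * (z * c)
    shuffle = solve-∀
    off : ∀ s i l → ℓ i ≢ l → lookup (lookup A s) i * lookup (lookup cs l) i * lookup z l ≡ 0ℤ
    off s i l ℓi≢l rewrite E.supported l {i} (λ i∈ → ℓi≢l (unique (i∈ℓ i) i∈)) =
      cong (_* lookup z l) (ℤP.*-zeroʳ (lookup (lookup A s) i))
  D-surjective : ∀ y → InKer A y → ∃[ z ] (∀ i → lookup y i ≡ lookup z (ℓ i) * coeff i)
  D-surjective y ky = tabulate (λ l → proj₁ (E.multiple l y ky)) , λ i →
    trans (proj₂ (E.multiple (ℓ i) y ky) i (i∈ℓ i))
      (cong (_* coeff i) (sym (lookup∘tabulate (λ l → proj₁ (E.multiple l y ky)) (ℓ i))))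

-- Transfer along bouquets

0≤-from-*ʳ : ∀ {x c} → 0ℤ < c → 0ℤ ≤ x * c → 0ℤ ≤ x
0≤-from-*ʳ {x} {c} 0<c h = ℤP.*-cancelʳ-≤-pos 0ℤ x c {{ℤ.positive 0<c}} h

0<-from-*ʳ : ∀ {x c} → 0ℤ < c → 0ℤ < x * c → 0ℤ < x
0<-from-*ʳ {x} {c} 0<c h = ℤP.*-cancelʳ-<-nonNeg {0ℤ} {x} c {{ℤ.nonNegative (ℤP.<⇒≤ 0<c)}} h

pos-neg+ : ∀ n → pos (- (+ n)) ≡ 0ℤ
pos-neg+ zero    = refl
pos-neg+ (suc n) = refl

p+s*0≡p : ∀ p s → p + s * 0ℤ ≡ p
p+s*0≡p = solve-∀

-- For c ≥ 0 the last summand vanishes; for c < 0 the positive part is x⁻|c| = (|x| - x⁺)|c|. One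
-- formula for both signs, with a shift depending only on |x|, is what makes `Lifts` affine in z.
pos-* : ∀ x c → pos (x * c) ≡ pos x * c + (pos x + pos (- x)) * pos (- c)
pos-* x (+ n) = trans (onto x) (sym (trans (cong (λ z → pos x * + n + (pos x + pos (- x)) * z) (pos-neg+ n))
    (p+s*0≡p (pos x * + n) (pos x + pos (- x)))))
  where
  onto : ∀ x → pos (x * + n) ≡ pos x * + n
  onto (+ k)    = trans (cong pos (sym (ℤP.pos-* k n))) (ℤP.pos-* k n)
  onto -[1+ k ] = pos-of-nonpos (subst (_≤ 0ℤ) (ℤP.neg-distribˡ-* (+ suc k) (+ n))
    (ℤP.neg-mono-≤ (0≤* {+ suc k} {+ n} (+≤+ ℕ.z≤n) (+≤+ ℕ.z≤n))))
pos-* x -[1+ n ] = trans (onto x) (regroup (pos x) (pos (- x)) (+ suc n))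
  where
  regroup : ∀ p m c → m * c ≡ p * - c + (p + m) * c
  regroup = solve-∀
  onto : ∀ x → pos (x * -[1+ n ]) ≡ pos (- x) * + suc n
  onto (+ k) = trans (pos-of-nonpos (subst (_≤ 0ℤ) (ℤP.neg-distribʳ-* (+ k) (+ suc n))
      (ℤP.neg-mono-≤ (0≤* {+ k} {+ suc n} (+≤+ ℕ.z≤n) (+≤+ ℕ.z≤n)))))
    (cong (_* + suc n) (sym (pos-neg+ k)))
  onto -[1+ k ] = refl

pos-neg-* : ∀ x c → pos (- (x * c)) ≡ pos (- x) * c + (pos x + pos (- x)) * pos (- c)
pos-neg-* x c = trans (cong pos (ℤP.neg-distribˡ-* x c)) (trans (pos-* (- x) c)
  (cong (λ s → pos (- x) * c + s * pos (- c))
    (trans (cong (λ z → pos (- x) + pos z) (ℤP.neg-involutive x)) (ℤP.+-comm (pos (- x)) (pos x)))))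

pos-neg-of-pos : ∀ {c} → 0ℤ < c → pos (- c) ≡ 0ℤ
pos-neg-of-pos 0<c = pos-of-nonpos (ℤP.neg-mono-≤ (ℤP.<⇒≤ 0<c))

-- With disjoint supports X + Y ≤ U, and the equal sums force X + Y = U, so X or Y would reach U at k.
both-occupied : ∀ {r} {X Y U : Fin r → ℤ} → (∀ k → 0ℤ ≤ X k) → (∀ k → 0ℤ ≤ Y k) → (∀ k → X k ≤ U k) → (∀ k → Y k ≤ U k) →
  sum X + sum Y ≡ sum U → ∀ {k} → X k < U k → Y k < U k → ∃[ j ] (0ℤ < X j × 0ℤ < Y j)
both-occupied {r} {X} {Y} {U} X≥0 Y≥0 X≤U Y≤U eq {k} Xk<Uk Yk<Uk with any? (λ j → (0ℤ ℤP.<? X j) ×-dec (0ℤ ℤP.<? Y j))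
... | yes found   = found
... | no disjoint = ⊥-elim (contradict (zero-or k))
  where
  zero-or : ∀ j → X j ≡ 0ℤ ⊎ Y j ≡ 0ℤ
  zero-or j with 0ℤ ℤP.<? X j | 0ℤ ℤP.<? Y j
  ... | yes p | yes q = ⊥-elim (disjoint (j , p , q))
  ... | no ¬p | _     = inj₁ (ℤP.≤-antisym (ℤP.≮⇒≥ ¬p) (X≥0 j))
  ... | yes _ | no ¬q = inj₂ (ℤP.≤-antisym (ℤP.≮⇒≥ ¬q) (Y≥0 j))
  room : Fin r → ℤ
  room j = U j - (X j + Y j)
  room≥0 : ∀ j → 0ℤ ≤ room j
  room≥0 j with zero-or j
  ... | inj₁ X≡0 rewrite X≡0 | ℤP.+-identityˡ (Y j) = gap (Y≤U j)
  ... | inj₂ Y≡0 rewrite Y≡0 | ℤP.+-identityʳ (X j) = gap (X≤U j)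
  no-room : ∀ j → U j ≡ X j + Y j
  no-room j = ℤP.i-j≡0⇒i≡j _ _ (sum-zero⇒zero room≥0 (trans (sum-sub U (λ j → X j + Y j))
    (trans (cong (λ z → sum U - z) (trans (∑-distrib-+ X Y) eq)) (ℤP.+-inverseʳ (sum U)))) j)
  contradict : X k ≡ 0ℤ ⊎ Y k ≡ 0ℤ → ⊥
  contradict (inj₁ X≡0) = ℤP.<-irrefl (sym (trans (no-room k) (trans (cong (_+ Y k) X≡0) (ℤP.+-identityˡ (Y k))))) Yk<Uk
  contradict (inj₂ Y≡0) = ℤP.<-irrefl (sym (trans (no-room k) (trans (cong (_+_ (X k)) Y≡0) (ℤP.+-identityʳ (X k))))) Xk<Uk

module Transfer {A : Mat m n} {AB : Mat m q} (bouquets : Bouquets A AB) (r : ℕ) where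
  open Bouquets bouquets
  private
    module Q = Blocks q
    module N = Blocks n

  MB : Mat (r ℕ.* m ℕ.+ q) (r ℕ.* q)
  MB = lawrence r AB

  MA : Mat (r ℕ.* m ℕ.+ n) (r ℕ.* n)
  MA = lawrence r A

  module GB = Minimal MB (Q.lawrence-homogeneous r AB)
  module GA = Minimal MA (N.lawrence-homogeneous r A)

  inB : Vec ℤ (r ℕ.* q) → Fin r → Fin q → ℤ
  inB z k l = lookup z (Fin.combine k l)

  inA : Vec ℤ (r ℕ.* n) → Fin r → Fin n → ℤ
  inA x k i = lookup x (Fin.combine k i)

  blown : Vec ℤ (r ℕ.* q) → Vec ℤ (r ℕ.* n)
  blown z = N.assemble r λ k i → inB z k (bouquet i) * coeff i

  inA-blown : ∀ z k i → inA (blown z) k i ≡ inB z k (bouquet i) * coeff i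
  inA-blown z = N.lookup-assemble r _

  ker-rows : ∀ y z → (∀ i → lookup y i ≡ lookup z (bouquet i) * coeff i) → A ·ᵥ y ≡ AB ·ᵥ z
  ker-rows y z h = trans (cong (A ·ᵥ_) (vec-ext λ i → trans (h i) (sym (lookup∘tabulate _ i)))) (D-product z)

  blown-ker : ∀ {z} → InKer MB z → InKer MA (blown z)
  blown-ker {z} kz with rows , cols ← Q.lawrence-ker⁻ r AB z kz = N.lawrence-ker⁺ r A (blown z)
    (λ k → trans (ker-rows (N.row r (blown z) k) (Q.row r z k)
       λ i → trans (N.lookup-row r (blown z) k i) (trans (inA-blown z k i)
         (cong (_* coeff i) (sym (Q.lookup-row r z k (bouquet i)))))) (rows k))
    λ i → trans (sum-cong-≗ λ k → inA-blown z k i)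
      (trans (sym (*-distribʳ-sum (coeff i) (λ k → inB z k (bouquet i)))) (cong (_* coeff i) (cols (bouquet i))))

  blown-surjective : ∀ {y} → InKer MA y → ∃[ z ] (InKer MB z × (∀ k i → inA y k i ≡ inB z k (bouquet i) * coeff i))
  blown-surjective {y} ky with rows , cols ← N.lawrence-ker⁻ r A y ky = z , z-ker , y≡
    where
    zRow : Fin r → Vec ℤ q
    zRow k = proj₁ (D-surjective (N.row r y k) (rows k))
    z : Vec ℤ (r ℕ.* q)
    z = Q.assemble r λ k → lookup (zRow k)
    y≡ : ∀ k i → inA y k i ≡ inB z k (bouquet i) * coeff i
    y≡ k i = trans (sym (N.lookup-row r y k i)) (trans (proj₂ (D-surjective (N.row r y k) (rows k)) i)
      (cong (_* coeff i) (sym (Q.lookup-assemble r _ k (bouquet i)))))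
    z-ker : InKer MB z
    z-ker = Q.lawrence-ker⁺ r AB z
      (λ k → trans (sym (ker-rows (N.row r y k) (Q.row r z k) λ i → trans (N.lookup-row r y k i)
        (trans (y≡ k i) (cong (_* coeff i) (sym (Q.lookup-row r z k (bouquet i))))))) (rows k))
      -- The column sum of `z` at bouquet `l` is read off at `rep l`, where it appears in `y`
      -- multiplied by a nonzero coefficient.
      λ l → *-≡0 {coeff (rep l)} (coeff≢0 (rep l)) (trans (ℤP.*-comm (coeff (rep l)) (sum (λ k → inB z k l)))
        (trans (*-distribʳ-sum (coeff (rep l)) (λ k → inB z k l))
        (trans (sum-cong-≗ λ k → trans (cong (λ l′ → inB z k l′ * coeff (rep l)) (sym (bouquet-rep l))) (sym (y≡ k (rep l))))
               (cols (rep l)))))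

  module _ {u : Vec ℤ (r ℕ.* q)} (ku : InKer MB u) where

    size : Fin r → Fin q → ℤ
    size k l = pos (inB u k l) + pos (- inB u k l)

    -- Where the coefficient of the bouquet is negative, the fibre of blown u sees the complement of z in ∣u∣.
    Lifts : Vec ℤ (r ℕ.* n) → Vec ℤ (r ℕ.* q) → Set
    Lifts x z = ∀ k i → inA x k i ≡ inB z k (bouquet i) * coeff i + size k (bouquet i) * pos (- coeff i)

    lifts-pos : Lifts (posV (blown u)) (posV u)
    lifts-pos k i = trans (lookup-posV (blown u) _) (trans (cong pos (inA-blown u k i))
      (trans (pos-* (inB u k (bouquet i)) (coeff i))
        (cong (λ z → z * coeff i + size k (bouquet i) * pos (- coeff i)) (sym (lookup-posV u _)))))

    lifts-neg : Lifts (posV (negV (blown u))) (posV (negV u))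
    lifts-neg k i = trans (lookup-posV-negV (blown u) _) (trans (cong (λ z → pos (- z)) (inA-blown u k i))
      (trans (pos-neg-* (inB u k (bouquet i)) (coeff i))
        (cong (λ z → z * coeff i + size k (bouquet i) * pos (- coeff i)) (sym (lookup-posV-negV u _)))))

    -- The coefficient at a representative is positive, so the complement term disappears.
    -- Injectivity and nonnegativity of lifts both follow from this.
    lifts-rep : ∀ {x z} → Lifts x z → ∀ k l → inA x k (rep l) ≡ inB z k l * coeff (rep l)
    lifts-rep {x} {z} lift k l = trans (lift k (rep l))
      (trans (cong (λ w → inB z k (bouquet (rep l)) * coeff (rep l) + size k (bouquet (rep l)) * w) (pos-neg-of-pos (coeff-rep l)))
      (trans (p+s*0≡p (inB z k (bouquet (rep l)) * coeff (rep l)) (size k (bouquet (rep l))))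
             (cong (λ l′ → inB z k l′ * coeff (rep l)) (bouquet-rep l))))

    lifts-injective : ∀ {x z z′} → Lifts x z → Lifts x z′ → z ≡ z′
    lifts-injective {x} {z} {z′} h h′ = vec-ext (Q.combine-elim r _ λ k l →
      *-cancel {coeff (rep l)} (coeff≢0 (rep l)) (trans (ℤP.*-comm (coeff (rep l)) (inB z k l))
        (trans (trans (sym (lifts-rep {x} {z} h k l)) (lifts-rep {x} {z′} h′ k l)) (ℤP.*-comm (inB z′ k l) (coeff (rep l))))))

    lifts-nonneg : ∀ {x z} → Lifts x z → NonNegV x → NonNegV z
    lifts-nonneg {x} {z} h x≥0 = Q.combine-elim r _ λ k l →
      0≤-from-*ʳ (coeff-rep l) (subst (0ℤ ≤_) (lifts-rep {x} {z} h k l) (x≥0 _))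

    column-sum : ∀ {z} → InKer MB (posV u ⊖ z) → ∀ l → sum (λ k → inB z k l) ≡ sum (λ k → inB (posV u) k l)
    column-sum {z} k l = sym (ℤP.i-j≡0⇒i≡j _ _ (trans (sym (sum-sub (λ k → inB (posV u) k l) (λ k → inB z k l)))
      (trans (sum-cong-≗ {r} λ k → sym (lookup-⊖ (posV u) z (Fin.combine k l))) (proj₂ (Q.lawrence-ker⁻ r AB (posV u ⊖ z) k) l))))

    lifts-negative : ∀ {x z} → Lifts x z → ∀ {i} → coeff i < 0ℤ → ∀ k →
      inA x k i ≡ (size k (bouquet i) - inB z k (bouquet i)) * - coeff i
    lifts-negative {x} {z} h {i} c<0 k = trans (h k i)
      (trans (cong (λ w → inB z k (bouquet i) * coeff i + size k (bouquet i) * w) (pos-of-nonneg (ℤP.<⇒≤ (ℤP.neg-mono-< c<0))))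
             (regroup (inB z k (bouquet i)) (coeff i) (size k (bouquet i))))
      where
      regroup : ∀ z c s → z * c + s * - c ≡ (s - z) * - c
      regroup = solve-∀

    -- At a positive coefficient `z` and `w` meet in the same row `k`. At a negative one the meeting
    -- place may be in another row of the column, and `both-occupied` finds it.
    shared : ∀ {x y z w} → NonNegV x → NonNegV y → Lifts x z → Lifts y w →
      InKer MB (posV u ⊖ z) → InKer MB (posV u ⊖ w) →
      ∀ k i → 0ℤ < inA x k i → 0ℤ < inA y k i → ∃[ t ] (0ℤ < lookup z t × 0ℤ < lookup w t)
    shared {x} {y} {z} {w} x≥0 y≥0 hx hy kz kw k i 0<x 0<y with ℤP.<-cmp 0ℤ (coeff i)
    ... | tri≈ _ 0≡c _ = ⊥-elim (coeff≢0 i (sym 0≡c))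
    ... | tri< 0<c _ _ = Fin.combine k (bouquet i) , positive x z hx 0<x , positive y w hy 0<y
      where
      positive : ∀ x z → Lifts x z → 0ℤ < inA x k i → 0ℤ < inB z k (bouquet i)
      positive x z h 0<x = 0<-from-*ʳ 0<c (subst (0ℤ <_) (trans (h k i)
        (trans (cong (λ p → inB z k (bouquet i) * coeff i + size k (bouquet i) * p) (pos-neg-of-pos 0<c))
               (p+s*0≡p (inB z k (bouquet i) * coeff i) (size k (bouquet i))))) 0<x)
    ... | tri> _ _ c<0 = Fin.combine (proj₁ occupied) l , proj₂ occupied
      where
      l : Fin q
      l = bouquet i
      0<-c : 0ℤ < - coeff i
      0<-c = ℤP.neg-mono-< c<0
      bounded : ∀ x z → Lifts x z → NonNegV x → ∀ k → inB z k l ≤ size k l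
      bounded x z h x≥0 k = ℤP.0≤i-j⇒j≤i (0≤-from-*ʳ {size k l - inB z k l} 0<-c (subst (0ℤ ≤_) (lifts-negative {x} {z} h c<0 k) (x≥0 _)))
      strict : ∀ x z → Lifts x z → 0ℤ < inA x k i → inB z k l < size k l
      strict x z h 0<x = subst₂ _<_ (ℤP.+-identityˡ (inB z k l)) (restore (size k l) (inB z k l))
        (ℤP.+-monoˡ-< (inB z k l) (0<-from-*ʳ {size k l - inB z k l} 0<-c (subst (0ℤ <_) (lifts-negative {x} {z} h c<0 k) 0<x)))
        where
        restore : ∀ s z → s - z + z ≡ s
        restore = solve-∀
      -- `posV (negV u)` is itself in the fibre of `posV u`, so the column sum of `w` may be
      -- replaced by that of the negative part; the two parts add up to `size`.
      totals : sum (λ k → inB z k l) + sum (λ k → inB w k l) ≡ sum (λ k → size k l)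
      totals = trans (cong₂ _+_ (column-sum kz l)
          (trans (column-sum kw l) (sym (column-sum (subst (InKer MB) (sym (posV-split u)) ku) l))))
        (trans (sym (∑-distrib-+ (λ k → inB (posV u) k l) (λ k → inB (posV (negV u)) k l)))
          (sum-cong-≗ {r} λ k → cong₂ _+_ (lookup-posV u (Fin.combine k l)) (lookup-posV-negV u (Fin.combine k l))))
      occupied : ∃[ j ] (0ℤ < inB z j l × 0ℤ < inB w j l)
      occupied = both-occupied
        (λ k → lifts-nonneg {x} {z} hx x≥0 (Fin.combine k l)) (λ k → lifts-nonneg {y} {w} hy y≥0 (Fin.combine k l))
        (bounded x z hx x≥0) (bounded y w hy y≥0) totals (strict x z hx 0<x) (strict y w hy 0<y)

    -- Each difference in the chain is `blown v` for some kernel vector `v`, and since the shift in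
    -- `Lifts` is fixed, subtracting `v` from `z` follows the chain. At its end injectivity
    -- identifies the point reached with `w`.
    descend : ∀ {x y z w} → NonNegV x → GA.Linked x y → Lifts x z → Lifts y w → InKer MB (posV u ⊖ z) → GB.Linked z w
    descend {x} {y} {z} {w} x≥0 GA.refl-link hx hy kz = subst (GB.Linked z) (lifts-injective {x} {z} {w} hx hy) GB.refl-link
    descend {x} {y} {z} {w} x≥0 (GA.link {b = b} b≥0 kxb (t , 0<x , 0<b) rest) hx hy kz
      with v , kv , x-b ← blown-surjective kxb
      with k , i , refl ← combine-surjective {r} {n} t =
      GB.link (lifts-nonneg {b} {z ⊖ v} hb b≥0) (subst (InKer MB) (sym (⊖-⊖ z v)) kv)
        (shared {x} {b} {z} {z ⊖ v} x≥0 b≥0 hx hb kz kz′ k i 0<x 0<b)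
        (descend b≥0 rest hb hy kz′)
      where
      hb : Lifts b (z ⊖ v)
      hb k i = trans (back (inA x k i) (inA b k i))
        (trans (cong₂ _-_ (hx k i) (trans (sym (lookup-⊖ x b _)) (x-b k i)))
        (trans (collect (inB z k (bouquet i)) (inB v k (bouquet i)) (coeff i) (size k (bouquet i) * pos (- coeff i)))
               (cong (λ p → p * coeff i + size k (bouquet i) * pos (- coeff i)) (sym (lookup-⊖ z v _)))))
        where
        back : ∀ x b → b ≡ x - (x - b)
        back = solve-∀
        collect : ∀ z v c s → z * c + s - v * c ≡ (z - v) * c + s
        collect = solve-∀
      kz′ : InKer MB (posV u ⊖ (z ⊖ v))
      kz′ = subst (InKer MB) regroup (ker-⊖ MB kz (ker-negV MB kv))
        where
        assoc : ∀ p z v → p - z - - v ≡ p - (z - v)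
        assoc = solve-∀
        regroup : (posV u ⊖ z) ⊖ negV v ≡ posV u ⊖ (z ⊖ v)
        regroup = vec-ext λ t → trans (lookup-⊖ (posV u ⊖ z) (negV v) t)
          (trans (cong₂ _-_ (lookup-⊖ (posV u) z t) (lookup-negV v t))
          (trans (assoc (lookup (posV u) t) (lookup z t) (lookup v t))
          (sym (trans (lookup-⊖ (posV u) (z ⊖ v) t) (cong (λ p → lookup (posV u) t - p) (lookup-⊖ z v t))))))

  blown-umb : ∀ {u} → InUniversalMarkovBasis MB u → InUniversalMarkovBasis MA (blown u)
  blown-umb {u} umb@(L , ((mb , _) , u∈L)) =
    GA.unlinked⇒umb (proj₂ (markovBasis MA)) (blown-ker ku) λ linked → GB.umb⇒unlinked umb
      (descend ku {posV (blown u)} {posV (negV (blown u))} (posV-nonneg (blown u)) linked (lifts-pos ku) (lifts-neg ku)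
        (subst (InKer MB) (sym (⊖-self (posV u))) (ker-zero MB)))
    where
    ku : InKer MB u
    ku = GB.ker± (proj₁ mb) u∈L

  -- A nonzero entry in column `l` stays nonzero at `rep l`, so no nonzero row is lost.
  blown-type : ∀ u → typeOf r u ℕ.≤ typeOf r (blown u)
  blown-type u = count-mono _ _ (blocks r u) (blocks r (blown u)) λ k nonzero zero′ → nonzero
    (vec-ext λ l → trans (cong (λ v → lookup v l) (Q.lookup-blocks r u k)) (trans (Q.lookup-row r u k l)
      (trans (*-≡0 {coeff (rep l)} (coeff≢0 (rep l)) (vanish k l zero′)) (sym (lookup-zeroV l)))))
    where
    vanish : ∀ k l → lookup (blocks r (blown u)) k ≡ zeroV → coeff (rep l) * inB u k l ≡ 0ℤ
    vanish k l zero′ = trans (ℤP.*-comm (coeff (rep l)) (inB u k l))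
      (trans (cong (λ l′ → inB u k l′ * coeff (rep l)) (sym (bouquet-rep l)))
      (trans (sym (inA-blown u k (rep l)))
      (trans (sym (N.lookup-row r (blown u) k (rep l)))
      (trans (cong (λ v → lookup v (rep l)) (trans (sym (N.lookup-blocks r (blown u) k)) zero′)) (lookup-zeroV (rep l))))))

theorem3p6 : ∀ {m n q : ℕ} (A : Mat m n) (AB : Mat m q) →
    IsBouquetMatrix A AB → MarkovComplexity≥ A AB
theorem3p6 A AB isBouquetMatrix t (r , 2≤r , u , umb , type≡t) =
  typeOf r (blown u) , (r , 2≤r , blown u , blown-umb umb , refl) ,
  subst (ℕ._≤ typeOf r (blown u)) type≡t (blown-type u)
  where
  open Transfer (bouquets isBouquetMatrix) r
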